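{- Let $\mathcal{R}$ be a finite valuation ring with residue field of cardinality $q$ and with uniformizer of nilpotency degree $r$ (so $|\mathcal{R}|=q^r$), and let $\mathcal{R}^*$ denote its group of units. Let $G$ be a subgroup of $\mathcal{R}^*$, let $g,h\colon G\to\mathcal{R}^*$ be arbitrary functions, and define $f\colon G\times\mathcal{R}^*\to\mathcal{R}$ by $f(x,y)=g(x)(h(x)+y)$. Put $m=\mu(g\cdot h)$, where $(g\cdot h)(x)=g(x)h(x)$. Then there is a constant $c>0$ depending only on $r$ such that for all sets $A\subset G$ and $B,C\subset\mathcal{R}^*$, \[|f(A,B)|\,|B\cdot C|\ \ge\ c\min\left\{\frac{q^r|B|}{m},\ \frac{|A||B|^2|C|}{m^2q^{2r-1}}\right\}.\]
   Context: A finite valuation ring is a finite commutative ring with identity that is local (has a unique maximal ideal) and principal (every ideal is principal); its maximal ideal is generated by a non-unit $z$ (a uniformizer), the residue field $\mathcal{R}/(z)$ has $q$ elements, and $r$ is the least integer with $z^r=0$. For a function $\varphi\colon G\to\mathcal{R}$, $\mu(\varphi)=\max_{t\in\mathcal{R}}|\{x\in G:\varphi(x)=t\}|$. Notation: $f(A,B)=\{f(x,y):x\in A,y\in B\}$ and $B\cdot C=\{bc:b\in B,c\in C\}$. -}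

module Defs where

open import Algebra.Bundles using (CommutativeRing)
import Algebra.Definitions as AlgebraDefinitions
import Algebra.Definitions.RawMagma as RawMagmaDefinitions
import Algebra.Properties.Semiring.Exp as SemiringExp
import Algebra.Properties.Ring as RingProperties
open import Data.Fin.Base using (Fin)
import Data.Fin.Properties as Fin
open import Data.Fin.Subset using (Subset; _∈_; _⊆_; _⊂_; ∣_∣; ⊤; ⁅_⁆)
open import Data.Fin.Subset.Properties using (_∈?_; x∈⁅y⁆⇒x≡y; ∣⁅x⁆∣≡1; p⊆q⇒∣p∣≤∣q∣)
open import Data.List.Base using (map; allFin)
open import Data.List.Extrema.Nat using (max; xs≤max)
import Data.List.Relation.Unary.All as All
open import Data.List.Membership.Propositional.Properties using (∈-map⁺; ∈-allFin)
open import Data.Nat.Base as ℕ using (ℕ; NonZero)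
import Data.Nat.Properties as ℕ
open import Data.Product.Base using (Σ; ∃; _×_; _,_; proj₁; proj₂)
open import Data.Product using (∃!)
open import Data.Product.Relation.Binary.Pointwise.NonDependent using (_×ₛ_)
open import Data.Vec.Base using (tabulate)
open import Data.Vec.Properties using ([]=⇒lookup; lookup⇒[]=; lookup∘tabulate)
open import Function.Bundles using (Func; Inverse; _⇔_)
open import Function.Properties.Inverse using (Inverse⇒Injection)
open import Level using (Level; _⊔_) renaming (suc to lsuc)
open import Relation.Binary.Bundles using (Setoid)
import Relation.Binary.Construct.On as On
open import Relation.Binary.Definitions using (_Respects_) renaming (Decidable to Decidable₂)
open import Relation.Binary.PropositionalEquality as ≡ using (_≡_; _≢_)
open import Relation.Nullary.Decidable using (Dec; yes; no; does; map′; _×-dec_; via-injection; dec-true)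
open import Relation.Nullary.Negation using (¬_)
open import Relation.Unary using (Pred; Decidable)

private
  variable
    p : Level

HasCardinality : ∀ {a ℓ} → Setoid a ℓ → ℕ → Set (a ⊔ ℓ)
HasCardinality S n = Inverse S (≡.setoid (Fin n))

record FiniteCommutativeRing a ℓ : Set (lsuc (a ⊔ ℓ)) where
  field
    commutativeRing : CommutativeRing a ℓ
    size            : ℕ
    enumeration     : HasCardinality (CommutativeRing.setoid commutativeRing) size

module FiniteRing {a ℓ} (R : FiniteCommutativeRing a ℓ) where

  open FiniteCommutativeRing R public
  open CommutativeRing commutativeRing public
  open RawMagmaDefinitions *-rawMagma public using (_∣ˡ_; _,_)
  open SemiringExp semiring public using (_^_)
  open RingProperties ring using (-‿distribʳ-*; ⁻¹-anti-homo-//)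
  open AlgebraDefinitions _≈_ using (Invertible)
  open Inverse enumeration public using ()
    renaming (to to index; from to element; to-cong to index-cong)

  infix 4 _≈?_

  _≈?_ : Decidable₂ _≈_
  _≈?_ = via-injection (Inverse⇒Injection enumeration) Fin._≟_

  element-index : ∀ x → element (index x) ≈ x
  element-index = Inverse.strictlyInverseʳ enumeration

  index-element : ∀ i → index (element i) ≡ i
  index-element = Inverse.strictlyInverseˡ enumeration

  -- A set of ring elements is a `Subset size`, read through the enumeration.
  -- Such sets have decidable membership, automatically respect _≈_, and
  -- have the library cardinality ∣_∣.

  infix 4 _∈ᴿ_

  _∈ᴿ_ : Carrier → Subset size → Set
  x ∈ᴿ S = index x ∈ S

  -- { x ∣ P x }. Meaningful only for predicates that respect _≈_, since P is
  -- tested on the chosen representatives `element i`.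

  ⟦_⟧ : {P : Pred Carrier p} → Decidable P → Subset size
  ⟦ P? ⟧ = tabulate (λ i → does (P? (element i)))

  ∈-⟦⟧⁺ : {P : Pred Carrier p} (P? : Decidable P) → P Respects _≈_ →
          ∀ {x} → P x → x ∈ᴿ ⟦ P? ⟧
  ∈-⟦⟧⁺ P? resp {x} Px = lookup⇒[]= (index x) ⟦ P? ⟧
    (≡.trans (lookup∘tabulate _ (index x))
             (dec-true (P? _) (resp (sym (element-index x)) Px)))

  ∈-⟦⟧⁻ : {P : Pred Carrier p} (P? : Decidable P) → P Respects _≈_ →
          ∀ {x} → x ∈ᴿ ⟦ P? ⟧ → P x
  ∈-⟦⟧⁻ P? resp {x} x∈ with P? (element (index x))
                          | ≡.trans (≡.sym (lookup∘tabulate (λ i → does (P? (element i))) (index x)))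
                                    ([]=⇒lookup x∈)
  ... | yes Px | _  = resp (element-index x) Px
  ... | no  _  | ()

  ⟪_⟫ : Subset size → Setoid a ℓ
  ⟪ S ⟫ = On.setoid {B = Σ Carrier (_∈ᴿ S)} setoid proj₁

  El : Subset size → Set a
  El S = Setoid.Carrier ⟪ S ⟫

  ∃? : ∀ S {P : Pred (El S) p} → P Respects (Setoid._≈_ ⟪ S ⟫) → Decidable P → Dec (∃ P)
  ∃? S {P} resp P? = map′
    (λ { (i , i∈S , Pi) → (element i , i∈S) , Pi })
    (λ { ((x , x∈S) , Px) → index x
       , ≡.subst (_∈ S) (≡.sym (index-element (index x))) x∈S
       , resp (sym (element-index x)) Px })
    (Fin.any? witness?)
    where
    witness? : Decidable (λ i → Σ (element i ∈ᴿ S) λ i∈S → P (element i , i∈S))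
    witness? i with index (element i) ∈? S
    ... | no  i∉S = no (λ w → i∉S (proj₁ w))
    ... | yes i∈S = map′ (i∈S ,_) (λ w → resp refl (proj₂ w)) (P? (element i , i∈S))

  IsUnit : Pred Carrier (a ⊔ ℓ)
  IsUnit = Invertible 1# _*_

  isUnit? : Decidable IsUnit
  isUnit? x = map′
    (λ { (i , eqs) → element i , eqs })
    (λ { (y , yx≈1 , xy≈1) → index y
       , trans (*-congʳ (element-index y)) yx≈1
       , trans (*-congˡ (element-index y)) xy≈1 })
    (Fin.any? (λ i → (element i * x ≈? 1#) ×-dec (x * element i ≈? 1#)))

  R* : Subset size
  R* = ⟦ isUnit? ⟧

  record IsSubgroup (G : Subset size) : Set (a ⊔ ℓ) where
    field
      G⊆R*       : G ⊆ R*
      1∈G        : 1# ∈ᴿ G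
      *-closed   : ∀ {x y} → x ∈ᴿ G → y ∈ᴿ G → (x * y) ∈ᴿ G
      inv-closed : ∀ {x y} → x ∈ᴿ G → x * y ≈ 1# → y ∈ᴿ G

  record IsIdeal (I : Subset size) : Set a where
    field
      0∈I      : 0# ∈ᴿ I
      +-closed : ∀ {x y} → x ∈ᴿ I → y ∈ᴿ I → (x + y) ∈ᴿ I
      *-absorb : ∀ x {y} → y ∈ᴿ I → (x * y) ∈ᴿ I

  record IsMaximalIdeal (M : Subset size) : Set a where
    field
      isIdeal : IsIdeal M
      proper  : M ≢ ⊤
      maximal : ∀ J → IsIdeal J → M ⊂ J → J ≡ ⊤

  _Generates_ : Carrier → Subset size → Set (a ⊔ ℓ)
  x Generates I = ∀ y → y ∈ᴿ I ⇔ x ∣ˡ y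

  IsLocal : Set a
  IsLocal = ∃! _≡_ IsMaximalIdeal

  IsPrincipal : Set (a ⊔ ℓ)
  IsPrincipal = ∀ I → IsIdeal I → ∃ (_Generates I)

  -- The residue ring R/(z): x and y are identified when z ∣ x - y.

  residueRing : Carrier → Setoid a (a ⊔ ℓ)
  residueRing z = record
    { Carrier       = Carrier
    ; _≈_           = λ x y → z ∣ˡ (x - y)
    ; isEquivalence = record
      { refl  = λ {x} → 0# , trans (zeroʳ z) (sym (-‿inverseʳ x))
      ; sym   = λ { {x} {y} (k , zk≈x-y) → - k
                  , trans (sym (-‿distribʳ-* z k))
                          (trans (-‿cong zk≈x-y) (⁻¹-anti-homo-// x y)) }
      ; trans = λ { {x} {y} {w} (j , zj≈x-y) (k , zk≈y-w) → j + k
                  , trans (distribˡ z j k)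
                          (trans (+-cong zj≈x-y zk≈y-w) (telescope x y w)) }
      }
    }
    where
    telescope : ∀ x y w → (x - y) + (y - w) ≈ x - w
    telescope x y w = trans (+-assoc x (- y) (y - w))
      (+-congˡ (trans (sym (+-assoc (- y) y (- w)))
                      (trans (+-congʳ (-‿inverseˡ y)) (+-identityˡ (- w)))))

  IsNilpotencyDegree : Carrier → ℕ → Set ℓ
  IsNilpotencyDegree z r = z ^ r ≈ 0# × (∀ k → k ℕ.< r → ¬ z ^ k ≈ 0#)

  Fibre : ∀ {S} → Func ⟪ S ⟫ setoid → Carrier → Pred Carrier ℓ
  Fibre {S} φ t x = Σ (x ∈ᴿ S) λ x∈S → Func.to φ (x , x∈S) ≈ t

  fibre? : ∀ {S} (φ : Func ⟪ S ⟫ setoid) t → Decidable (Fibre φ t)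
  fibre? {S} φ t x with index x ∈? S
  ... | no  x∉S = no (λ w → x∉S (proj₁ w))
  ... | yes x∈S = map′ (x∈S ,_) (λ w → trans (Func.cong φ refl) (proj₂ w))
                       (Func.to φ (x , x∈S) ≈? t)

  Fibre-resp : ∀ {S} (φ : Func ⟪ S ⟫ setoid) t → Fibre φ t Respects _≈_
  Fibre-resp {S} φ t x≈y (x∈S , φx≈t) =
    ≡.subst (_∈ S) (index-cong x≈y) x∈S , trans (Func.cong φ (sym x≈y)) φx≈t

  -- The base value 0 does not affect the maximum: R is non-empty.

  μ : ∀ {S} → Func ⟪ S ⟫ setoid → ℕ
  μ φ = max 0 (map (λ i → ∣ ⟦ fibre? φ (element i) ⟧ ∣) (allFin size))

  μ-nonZero : ∀ {G} → IsSubgroup G → (φ : Func ⟪ G ⟫ setoid) → NonZero (μ φ)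
  μ-nonZero isG φ = ℕ.>-nonZero (ℕ.≤-trans one≤fibre
    (All.lookup (xs≤max 0 _)
      (∈-map⁺ (λ i → ∣ ⟦ fibre? φ (element i) ⟧ ∣) (∈-allFin (index t)))))
    where
    t = Func.to φ (1# , IsSubgroup.1∈G isG)
    F = ⟦ fibre? φ (element (index t)) ⟧
    1∈F : 1# ∈ᴿ F
    1∈F = ∈-⟦⟧⁺ (fibre? φ (element (index t))) (Fibre-resp φ _)
            (IsSubgroup.1∈G isG , sym (element-index t))
    one≤fibre : 1 ℕ.≤ ∣ F ∣
    one≤fibre = ≡.subst (ℕ._≤ ∣ F ∣) (∣⁅x⁆∣≡1 (index 1#))
      (p⊆q⇒∣p∣≤∣q∣ {p = ⁅ index 1# ⁆}
        (λ i∈ → ≡.subst (_∈ F) (≡.sym (x∈⁅y⁆⇒x≡y _ i∈)) 1∈F))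

  -- For f : S × T → R and A ⊆ S, B ⊆ T, the set f(A,B) = { f(x,y) ∣ x ∈ A, y ∈ B }.

  image : ∀ {S T} → Func (⟪ S ⟫ ×ₛ ⟪ T ⟫) setoid → (A B : Subset size) → Subset size
  image {S} {T} f A B = ⟦ image? ⟧
    where
    Witness : Carrier → El S → El T → Set ℓ
    Witness t x y = proj₁ x ∈ᴿ A × proj₁ y ∈ᴿ B × Func.to f (x , y) ≈ t

    image? : Decidable (λ t → ∃ λ x → ∃ λ y → Witness t x y)
    image? t = ∃? S
      (λ { x≈x′ (y , x∈A , y∈B , eq) → y
         , ≡.subst (_∈ A) (index-cong x≈x′) x∈A , y∈B
         , trans (Func.cong f (sym x≈x′ , refl)) eq })
      (λ x → ∃? T
        (λ { y≈y′ (x∈A , y∈B , eq) → x∈A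
           , ≡.subst (_∈ B) (index-cong y≈y′) y∈B
           , trans (Func.cong f (refl , sym y≈y′)) eq })
        (λ y → (index (proj₁ x) ∈? A) ×-dec (index (proj₁ y) ∈? B)
               ×-dec (Func.to f (x , y) ≈? t)))

  infixl 7 _·_

  _·_ : (B C : Subset size) → Subset size
  B · C = ⟦ product? ⟧
    where
    product? : Decidable (λ t → ∃ λ ((b , _) : El B) → ∃ λ ((c , _) : El C) → b * c ≈ t)
    product? t = ∃? B
      (λ { b≈b′ (c , eq) → c , trans (*-congʳ (sym b≈b′)) eq })
      (λ b → ∃? C (λ c≈c′ eq → trans (*-congˡ (sym c≈c′)) eq)
                  (λ c → proj₁ b * proj₁ c ≈? t))

  module _ {G : Subset size} (g h : Func ⟪ G ⟫ ⟪ R* ⟫) where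

    private
      g⟨_⟩ h⟨_⟩ : El G → Carrier
      g⟨ x ⟩ = proj₁ (Func.to g x)
      h⟨ x ⟩ = proj₁ (Func.to h x)

    pointwiseProduct : Func ⟪ G ⟫ setoid
    pointwiseProduct = record
      { to   = λ x → g⟨ x ⟩ * h⟨ x ⟩
      ; cong = λ x≈x′ → *-cong (Func.cong g x≈x′) (Func.cong h x≈x′)
      }

    twistedSum : Func (⟪ G ⟫ ×ₛ ⟪ R* ⟫) setoid
    twistedSum = record
      { to   = λ (x , y) → g⟨ x ⟩ * (h⟨ x ⟩ + proj₁ y)
      ; cong = λ (x≈x′ , y≈y′) →
          *-cong (Func.cong g x≈x′) (+-cong (Func.cong h x≈x′) y≈y′)
      }

-- Finite valuation rings with a chosen uniformizer z, residue field of
-- cardinality q and nilpotency degree r. "Every ideal is principal" refers to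
-- ideals that are finite sets (decidable subsets); for arbitrary predicates it
-- would be a non-constructive principle.

record FiniteValuationRing a ℓ (q r : ℕ) : Set (lsuc (a ⊔ ℓ)) where
  field
    finiteCommutativeRing : FiniteCommutativeRing a ℓ

  open FiniteRing finiteCommutativeRing public

  field
    isLocal     : IsLocal
    isPrincipal : IsPrincipal

  maximalIdeal : Subset size
  maximalIdeal = proj₁ isLocal

  field
    z                  : Carrier
    z-generates        : z Generates maximalIdeal
    residueCardinality : HasCardinality (residueRing z) q
    nilpotencyDegree   : IsNilpotencyDegree z r

  q-nonZero : NonZero q
  q-nonZero = Fin.nonZeroIndex (Inverse.to residueCardinality 0#)

{-# OPTIONS --safe #-}

-- The pairs (x , c) ∈ A × C give |A||C| lines s = g(x)c⁻¹ t + g(x)h(x) in the plane R². Each of them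
-- meets the grid (B · C) × f(A , B) in at least |B| points, because t = bc gives s = f(x , b). Two lines
-- whose slopes differ by a unit have at most one common point. Given a line l, a line l′ whose slope
-- differs from that of l by d in the maximal ideal M and which meets l over t is determined by t, d and
-- x, and x lies in a fibre of g·h; so l has at most |R||M|m incidences with such lines. Hence the number
-- of lines through a point of R² has small variance around its mean |A||C|/|R|. A grid with fewer than
-- |R||B|/2 points carries incidences far above the mean, and Chebyshev's inequality bounds its size from
-- below. Expansions in powers of z give |R| = q^r and |M| ≤ q^(r−1).

module Submission where

open import Defs
import Algebra.Properties.Group as GroupProperties
import Algebra.Properties.Ring as RingProperties
import Algebra.Solver.Ring.NaturalCoefficients.Default as NaturalCoefficients
open import Data.Bool.Base using (if_then_else_)
open import Data.Fin.Base using (Fin; zero; suc; combine; remQuot)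
import Data.Fin.Properties as Fin
open import Data.Fin.Subset using (Subset; inside; outside; _∈_; _⊆_; ∣_∣; ⊤)
open import Data.Fin.Subset.Properties using (_∈?_; ∈⊤; ∣p∣≤n)
import Data.Integer.Base as ℤ
import Data.Integer.Properties as ℤ
open import Data.List.Base using (List; []; _∷_; _++_; map; length; allFin; cartesianProduct)
open import Data.List.Extrema.Nat using (xs≤max)
open import Data.List.Membership.Propositional using () renaming (_∈_ to _∈ˡ_)
open import Data.List.Membership.Propositional.Properties using (∈-map⁺; ∈-allFin; ∈-cartesianProduct⁺)
open import Data.List.Properties using (length-++; length-map; length-tabulate)
open import Data.List.Relation.Unary.All as All using (All; []; _∷_)
import Data.List.Relation.Unary.All.Properties as All
open import Data.List.Relation.Unary.AllPairs using ([]; _∷_)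
open import Data.List.Relation.Unary.Any using (here; there)
open import Data.List.Relation.Unary.Unique.Setoid using (Unique)
import Data.List.Relation.Unary.Unique.Setoid.Properties as Unique
open import Data.Nat.Base as ℕ using (ℕ; zero; suc; z≤n; s≤s; NonZero)
import Data.Nat.Properties as ℕ
open import Data.Nat.Properties using (m*n≢0; m^n≢0)
open import Data.Nat.Tactic.RingSolver using (solve-∀)
open import Data.Product.Base using (∃; ∃-syntax; _×_; _,_; proj₁; proj₂)
open import Data.Product.Relation.Binary.Pointwise.NonDependent using (_×ₛ_)
open import Data.Rational.Base as ℚ using (0ℚ; _/_; _⊓_; _<_; _≥_)
import Data.Rational.Properties as ℚ
import Data.Rational.Unnormalised.Base as ℚᵘ
import Data.Rational.Unnormalised.Properties as ℚᵘ
open import Data.Sum.Base using (_⊎_; inj₁; inj₂)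
open import Data.Vec.Base as Vec using ([]; _∷_)
open import Function.Base using (_∘_)
open import Function.Bundles using (Func; Inverse; module Equivalence)
open import Level using (Level)
open import Relation.Binary.Bundles using (Setoid)
import Relation.Binary.Construct.On as On
open import Relation.Binary.PropositionalEquality as ≡ using (_≡_)
open import Relation.Nullary.Decidable using (Dec; yes; no; does; dec-true; _×-dec_)
open import Relation.Nullary.Negation using (¬_; contradiction)
open import Relation.Unary using (Pred; Decidable)

private
  variable
    a b c : Level
    X Y : Set a

-- Finite sums over lists, indicators and double counting

module _ where
  open import Data.Nat.Base using (_+_; _*_; _≤_)

  ∑ : List X → (X → ℕ) → ℕ
  ∑ []       f = 0
  ∑ (x ∷ xs) f = f x + ∑ xs f

  ∑-mono : ∀ (xs : List X) {f g : X → ℕ} → (∀ x → x ∈ˡ xs → f x ≤ g x) → ∑ xs f ≤ ∑ xs g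
  ∑-mono []       f≤g = z≤n
  ∑-mono (x ∷ xs) f≤g = ℕ.+-mono-≤ (f≤g x (here ≡.refl)) (∑-mono xs (λ y y∈ → f≤g y (there y∈)))

  ∑-cong : ∀ (xs : List X) {f g : X → ℕ} → (∀ x → f x ≡ g x) → ∑ xs f ≡ ∑ xs g
  ∑-cong []       f≡g = ≡.refl
  ∑-cong (x ∷ xs) f≡g = ≡.cong₂ _+_ (f≡g x) (∑-cong xs f≡g)

  ∑-+ : ∀ (xs : List X) (f g : X → ℕ) → ∑ xs (λ x → f x + g x) ≡ ∑ xs f + ∑ xs g
  ∑-+ []       f g = ≡.refl
  ∑-+ (x ∷ xs) f g rewrite ∑-+ xs f g = interchange (f x) (g x) (∑ xs f) (∑ xs g)
    where
    interchange : ∀ i j k l → i + j + (k + l) ≡ i + k + (j + l)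
    interchange = solve-∀

  ∑-*ˡ : ∀ (xs : List X) c (f : X → ℕ) → ∑ xs (λ x → c * f x) ≡ c * ∑ xs f
  ∑-*ˡ []       c f = ≡.sym (ℕ.*-zeroʳ c)
  ∑-*ˡ (x ∷ xs) c f rewrite ∑-*ˡ xs c f = ≡.sym (ℕ.*-distribˡ-+ c (f x) (∑ xs f))

  ∑-*ʳ : ∀ (xs : List X) (f : X → ℕ) c → ∑ xs (λ x → f x * c) ≡ ∑ xs f * c
  ∑-*ʳ []       f c = ≡.refl
  ∑-*ʳ (x ∷ xs) f c rewrite ∑-*ʳ xs f c = ≡.sym (ℕ.*-distribʳ-+ c (f x) (∑ xs f))

  ∑-const : ∀ (xs : List X) c → ∑ xs (λ _ → c) ≡ length xs * c
  ∑-const []       c = ≡.refl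
  ∑-const (x ∷ xs) c = ≡.cong (c +_) (∑-const xs c)

  ∑-comm : ∀ (xs : List X) (ys : List Y) (f : X → Y → ℕ) →
           ∑ xs (λ x → ∑ ys (f x)) ≡ ∑ ys (λ y → ∑ xs (λ x → f x y))
  ∑-comm []       ys f = ≡.sym (≡.trans (∑-const ys 0) (ℕ.*-zeroʳ (length ys)))
  ∑-comm (x ∷ xs) ys f rewrite ∑-comm xs ys f = ≡.sym (∑-+ ys (f x) (λ y → ∑ xs (λ x → f x y)))

  ∑-map : ∀ (xs : List X) (h : X → Y) (f : Y → ℕ) → ∑ (map h xs) f ≡ ∑ xs (λ x → f (h x))
  ∑-map []       h f = ≡.refl
  ∑-map (x ∷ xs) h f = ≡.cong (f (h x) +_) (∑-map xs h f)

  ∑-++ : ∀ (xs ys : List X) (f : X → ℕ) → ∑ (xs ++ ys) f ≡ ∑ xs f + ∑ ys f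
  ∑-++ []       ys f = ≡.refl
  ∑-++ (x ∷ xs) ys f rewrite ∑-++ xs ys f = ≡.sym (ℕ.+-assoc (f x) (∑ xs f) (∑ ys f))

  ∑-× : ∀ (xs : List X) (ys : List Y) (f : X × Y → ℕ) →
        ∑ (cartesianProduct xs ys) f ≡ ∑ xs (λ x → ∑ ys (λ y → f (x , y)))
  ∑-× []       ys f = ≡.refl
  ∑-× (x ∷ xs) ys f = ≡.trans (∑-++ (map (x ,_) ys) (cartesianProduct xs ys) f)
    (≡.cong₂ _+_ (∑-map ys (x ,_) f) (∑-× xs ys f))

  length-× : ∀ (xs : List X) (ys : List Y) → length (cartesianProduct xs ys) ≡ length xs * length ys
  length-× []       ys = ≡.refl
  length-× (x ∷ xs) ys = ≡.trans (length-++ (map (x ,_) ys))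
    (≡.cong₂ _+_ (length-map (x ,_) ys) (length-× xs ys))

  term≤∑ : ∀ {x : X} {xs} (f : X → ℕ) → x ∈ˡ xs → f x ≤ ∑ xs f
  term≤∑ f (here ≡.refl)                = ℕ.m≤m+n _ _
  term≤∑ f (there {x = y} x∈) = ℕ.≤-trans (term≤∑ f x∈) (ℕ.m≤n+m _ (f y))

  -- Interchange of the two sums. With `f` and `g` constantly 1 and `Q` an indicator it compares
  -- cardinalities: if every x is related to some y, and each y to at most m of the x, then `xs` has
  -- at most m times as many entries as `ys`. In this form it replaces explicit injections in the
  -- counts below.
  double-count : ∀ (xs : List X) (ys : List Y) {f : X → ℕ} {g : Y → ℕ} {m} (Q : X → Y → ℕ) →
                 (∀ x → x ∈ˡ xs → f x ≤ ∑ ys (λ y → g y * Q x y)) →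
                 (∀ y → y ∈ˡ ys → ∑ xs (λ x → Q x y) ≤ m) →
                 ∑ xs f ≤ ∑ ys g * m
  double-count xs ys {f} {g} {m} Q covered few = begin
    ∑ xs f                                  ≤⟨ ∑-mono xs covered ⟩
    ∑ xs (λ x → ∑ ys (λ y → g y * Q x y))   ≡⟨ ∑-comm xs ys _ ⟩
    ∑ ys (λ y → ∑ xs (λ x → g y * Q x y))   ≡⟨ ∑-cong ys (λ y → ∑-*ˡ xs (g y) _) ⟩
    ∑ ys (λ y → g y * ∑ xs (λ x → Q x y))   ≤⟨ ∑-mono ys (λ y y∈ → ℕ.*-monoʳ-≤ (g y) (few y y∈)) ⟩
    ∑ ys (λ y → g y * m)                    ≡⟨ ∑-*ʳ ys g m ⟩
    ∑ ys g * m                              ∎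
    where open ℕ.≤-Reasoning

  χ : {P : Set c} → Dec P → ℕ
  χ P? = if does P? then 1 else 0

  χ-yes : {P : Set c} (P? : Dec P) → P → χ P? ≡ 1
  χ-yes P? Px rewrite dec-true P? Px = ≡.refl

  χ-mono : {P : Set a} {Q : Set b} (P? : Dec P) (Q? : Dec Q) → (P → Q) → χ P? ≤ χ Q?
  χ-mono (no _)   _  _   = z≤n
  χ-mono (yes Px) Q? P⇒Q = ℕ.≤-reflexive (≡.sym (χ-yes Q? (P⇒Q Px)))

  χ≤ : {P : Set c} (P? : Dec P) {n : ℕ} → (P → 1 ≤ n) → χ P? ≤ n
  χ≤ (no _)   _   = z≤n
  χ≤ (yes Px) P⇒ = P⇒ Px

  χ-* : {P : Set a} {Q : Set b} (P? : Dec P) (Q? : Dec Q) → χ P? * χ Q? ≡ χ (P? ×-dec Q?)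
  χ-* (yes _) Q? = ℕ.*-identityˡ (χ Q?)
  χ-* (no _)  Q? = ≡.refl

  module _ {s ℓ} (S : Setoid s ℓ) where
    open Setoid S

    -- After the first entry satisfying `P`, any further one would be equivalent to it, which
    -- uniqueness of the list forbids.
    ∑-χ≤1 : ∀ {xs} → Unique S xs → {P : Pred Carrier c} (P? : Decidable P) →
            (∀ {x y} → P x → P y → x ≈ y) → ∑ xs (λ x → χ (P? x)) ≤ 1
    ∑-χ≤1 []            P? P-prop = z≤n
    ∑-χ≤1 {xs = x ∷ xs} (x∉ ∷ xs!) P? P-prop with P? x
    ... | no  _  = ∑-χ≤1 xs! P? P-prop
    ... | yes Px = s≤s (zeros x∉)
      where
      zeros : ∀ {ys} → All (λ y → ¬ (x ≈ y)) ys → ∑ ys (λ y → χ (P? y)) ≤ 0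
      zeros []                         = z≤n
      zeros {y ∷ _} (x≉y ∷ x≉) with P? y
      ... | yes Py = contradiction (P-prop Px Py) x≉y
      ... | no  _  = zeros x≉

  -- The square of a difference without subtraction: the larger number is the smaller plus d, and
  -- the defect is d².
  2xy≤x²+y² : ∀ x y → 2 * (x * y) ≤ x * x + y * y
  2xy≤x²+y² x y with ℕ.≤-total x y
  ... | inj₁ x≤y with ℕ.m≤n⇒∃[o]m+o≡n x≤y
  ...   | d , ≡.refl = ≡.subst (2 * (x * (x + d)) ≤_) (≡.sym (identity x d)) (ℕ.m≤m+n _ (d * d))
    where
    identity : ∀ x d → x * x + (x + d) * (x + d) ≡ 2 * (x * (x + d)) + d * d
    identity = solve-∀
  2xy≤x²+y² x y | inj₂ y≤x with ℕ.m≤n⇒∃[o]m+o≡n y≤x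
  ...   | d , ≡.refl = ≡.subst (2 * ((y + d) * y) ≤_) (≡.sym (identity y d)) (ℕ.m≤m+n _ (d * d))
    where
    identity : ∀ y d → (y + d) * (y + d) + y * y ≡ 2 * ((y + d) * y) + d * d
    identity = solve-∀

  -- Second moment bound for incidences between lines and a set of points

  module Incidence (lines : List X) (points : List Y)
                   (incident : X → Y → ℕ) (weight : Y → ℕ)
                   -- Idempotence in ℕ means that a weight is 0 or 1, so the squared weights in the
                   -- expansion behind `quadratic` still sum to p.
                   (weight-idem : ∀ y → weight y * weight y ≡ weight y)
                   (n b w : ℕ)
                   (#points≡n² : length points ≡ n * n)
                   (line-size : ∀ ℓ → ℓ ∈ˡ lines → ∑ points (incident ℓ) ≡ n)
                   (rich : ∀ ℓ → ℓ ∈ˡ lines → b ≤ ∑ points (λ y → weight y * incident ℓ y))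
                   -- `w` is the excess over one common point per line ℓ′; the sum includes ℓ′ = ℓ.
                   (meet : ∀ ℓ → ℓ ∈ˡ lines →
                           ∑ lines (λ ℓ′ → ∑ points (λ y → incident ℓ y * incident ℓ′ y)) ≤ length lines + w)
                   where

    private
      k p : ℕ
      k = length lines
      p = ∑ points weight

      deg : Y → ℕ
      deg y = ∑ lines (λ ℓ → incident ℓ y)

      ∑deg : ∑ points deg ≡ k * n
      ∑deg = ≡.trans (∑-comm points lines (λ y ℓ → incident ℓ y)) (≡.trans
        (ℕ.≤-antisym (∑-mono lines (λ ℓ ℓ∈ → ℕ.≤-reflexive (line-size ℓ ℓ∈)))
                     (∑-mono lines (λ ℓ ℓ∈ → ℕ.≤-reflexive (≡.sym (line-size ℓ ℓ∈)))))
        (∑-const lines n))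

      kb≤∑weighted : k * b ≤ ∑ points (λ y → weight y * deg y)
      kb≤∑weighted = begin
        k * b                                                          ≡⟨ ∑-const lines b ⟨
        ∑ lines (λ _ → b)                                              ≤⟨ ∑-mono lines rich ⟩
        ∑ lines (λ ℓ → ∑ points (λ y → weight y * incident ℓ y))       ≡⟨ ∑-comm lines points _ ⟩
        ∑ points (λ y → ∑ lines (λ ℓ → weight y * incident ℓ y))       ≡⟨ ∑-cong points (λ y → ∑-*ˡ lines (weight y) _) ⟩
        ∑ points (λ y → weight y * deg y)                              ∎
        where open ℕ.≤-Reasoning

      -- The second moment counts triples of two lines and a common point, so `meet` bounds it line
      -- by line. As the mean of `deg` over the n² points is k/n, the sum of squared deviations is
      -- then at most kw.
      ∑deg² : ∑ points (λ y → deg y * deg y) ≤ k * (k + w)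
      ∑deg² = begin
        ∑ points (λ y → deg y * deg y)
          ≡⟨ ∑-cong points (λ y → ∑-*ʳ lines (λ ℓ → incident ℓ y) (deg y)) ⟨
        ∑ points (λ y → ∑ lines (λ ℓ → incident ℓ y * deg y))
          ≡⟨ ∑-cong points (λ y → ∑-cong lines (λ ℓ → ∑-*ˡ lines (incident ℓ y) _)) ⟨
        ∑ points (λ y → ∑ lines (λ ℓ → ∑ lines (λ ℓ′ → incident ℓ y * incident ℓ′ y)))
          ≡⟨ ∑-comm points lines _ ⟩
        ∑ lines (λ ℓ → ∑ points (λ y → ∑ lines (λ ℓ′ → incident ℓ y * incident ℓ′ y)))
          ≡⟨ ∑-cong lines (λ ℓ → ∑-comm points lines _) ⟩
        ∑ lines (λ ℓ → ∑ lines (λ ℓ′ → ∑ points (λ y → incident ℓ y * incident ℓ′ y)))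
          ≤⟨ ∑-mono lines meet ⟩
        ∑ lines (λ _ → k + w)
          ≡⟨ ∑-const lines (k + w) ⟩
        k * (k + w) ∎
        where open ℕ.≤-Reasoning

      -- The pointwise inequality is (2pn·deg − (2pk + nkb·weight))² ≥ 0.
      quadratic : 8 * p * p * n * k * (k * n) + 4 * p * n * n * k * b * (k * b)
                  ≤ 4 * p * p * n * n * (k * (k + w))
                    + (4 * p * p * k * k * (n * n) + (4 * p * n * k * k * b + n * n * k * k * b * b) * p)
      quadratic = begin
        8 * p * p * n * k * (k * n) + 4 * p * n * n * k * b * (k * b)
          ≤⟨ ℕ.+-mono-≤ (ℕ.≤-reflexive (≡.cong (8 * p * p * n * k *_) (≡.sym ∑deg)))
                        (ℕ.*-monoʳ-≤ (4 * p * n * n * k * b) kb≤∑weighted) ⟩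
        8 * p * p * n * k * ∑ points deg + 4 * p * n * n * k * b * ∑ points (λ y → weight y * deg y)
          ≡⟨ ≡.cong₂ _+_ (∑-*ˡ points (8 * p * p * n * k) _) (∑-*ˡ points (4 * p * n * n * k * b) _) ⟨
        ∑ points (λ y → 8 * p * p * n * k * deg y) + ∑ points (λ y → 4 * p * n * n * k * b * (weight y * deg y))
          ≡⟨ ∑-+ points _ _ ⟨
        ∑ points (λ y → 8 * p * p * n * k * deg y + 4 * p * n * n * k * b * (weight y * deg y))
          ≤⟨ ∑-mono points (λ y _ → pointwise y) ⟩
        ∑ points (λ y → 4 * p * p * n * n * (deg y * deg y)
                        + (4 * p * p * k * k + (4 * p * n * k * k * b + n * n * k * k * b * b) * weight y))
          ≡⟨ ≡.trans (∑-+ points _ _) (≡.cong₂ _+_ (∑-*ˡ points (4 * p * p * n * n) _)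
               (≡.trans (∑-+ points _ _) (≡.cong₂ _+_ (∑-const points _)
                 (∑-*ˡ points (4 * p * n * k * k * b + n * n * k * k * b * b) weight)))) ⟩
        4 * p * p * n * n * ∑ points (λ y → deg y * deg y)
          + (length points * (4 * p * p * k * k) + (4 * p * n * k * k * b + n * n * k * k * b * b) * p)
          ≤⟨ ℕ.+-mono-≤ (ℕ.*-monoʳ-≤ (4 * p * p * n * n) ∑deg²)
               (ℕ.+-monoˡ-≤ _ (ℕ.≤-reflexive
                 (≡.trans (≡.cong (_* (4 * p * p * k * k)) #points≡n²) (ℕ.*-comm (n * n) _)))) ⟩
        4 * p * p * n * n * (k * (k + w))
          + (4 * p * p * k * k * (n * n) + (4 * p * n * k * k * b + n * n * k * k * b * b) * p) ∎
        where
        open ℕ.≤-Reasoning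
        lhs : ∀ p n k b d u → 2 * (2 * p * n * d * (2 * p * k + n * k * b * u))
              ≡ 8 * p * p * n * k * d + 4 * p * n * n * k * b * (u * d)
        lhs = solve-∀
        rhs : ∀ p n k b d u → 2 * p * n * d * (2 * p * n * d) + (2 * p * k + n * k * b * u) * (2 * p * k + n * k * b * u)
              ≡ 4 * p * p * n * n * (d * d) + (4 * p * p * k * k + (4 * p * n * k * k * b * u + n * n * k * k * b * b * (u * u)))
        rhs = solve-∀
        collect : ∀ c d u → c * u + d * u ≡ (c + d) * u
        collect = solve-∀
        pointwise : ∀ y → 8 * p * p * n * k * deg y + 4 * p * n * n * k * b * (weight y * deg y)
                    ≤ 4 * p * p * n * n * (deg y * deg y)
                      + (4 * p * p * k * k + (4 * p * n * k * k * b + n * n * k * k * b * b) * weight y)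
        pointwise y = ≡.subst₂ _≤_ (lhs p n k b (deg y) (weight y))
          (≡.trans (rhs p n k b (deg y) (weight y))
            (≡.cong (λ t → 4 * p * p * n * n * (deg y * deg y) + (4 * p * p * k * k + t))
              (≡.trans (≡.cong (λ t → 4 * p * n * k * k * b * weight y + n * n * k * k * b * b * t) (weight-idem y))
                       (collect (4 * p * n * k * k * b) (n * n * k * k * b * b) (weight y)))))
          (2xy≤x²+y² (2 * p * n * deg y) (2 * p * k + n * k * b * weight y))

      -- A crude bound, each weight being at most the total p. It settles p = 0, where both sides of
      -- `quadratic` vanish, by forcing kb = 0.
      kb≤p·kn : k * b ≤ p * (k * n)
      kb≤p·kn = begin
        k * b                              ≤⟨ kb≤∑weighted ⟩
        ∑ points (λ y → weight y * deg y)  ≤⟨ ∑-mono points (λ y y∈ → ℕ.*-monoˡ-≤ (deg y) (term≤∑ weight y∈)) ⟩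
        ∑ points (λ y → p * deg y)         ≡⟨ ∑-*ˡ points p deg ⟩
        p * ∑ points deg                   ≡⟨ ≡.cong (p *_) ∑deg ⟩
        p * (k * n)                        ∎
        where open ℕ.≤-Reasoning

    -- Chebyshev's inequality. The weighted points carry at least kb incidences where the mean
    -- predicts pk/n ≤ kb/2, so their total deviation is at least kb/2. By Cauchy-Schwarz (kb/2)² is
    -- at most p times the sum of squared deviations, hence at most pkw. `quadratic` is this
    -- Cauchy-Schwarz step with its optimal multiplier kb/(2p) and denominators cleared; what
    -- remains is to cancel pn²k.
    few-points⇒ : .{{_ : NonZero n}} → 2 * p ≤ n * b → k * (b * b) ≤ 4 * p * w
    few-points⇒ 2p≤nb = finish p k kb≤p·kn 2p≤nb quadratic
      where
      -- `p` and `k` become variables so that their zero cases can be split off before the factor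
      -- pn²k is cancelled.
      finish : ∀ p k → k * b ≤ p * (k * n) → 2 * p ≤ n * b →
               8 * p * p * n * k * (k * n) + 4 * p * n * n * k * b * (k * b)
                 ≤ 4 * p * p * n * n * (k * (k + w))
                   + (4 * p * p * k * k * (n * n) + (4 * p * n * k * k * b + n * n * k * k * b * b) * p) →
               k * (b * b) ≤ 4 * p * w
      finish p         zero       _  _  _ = z≤n
      finish zero      k@(suc _)  kb≤0 _ _ = ≡.subst (_≤ 0) (ℕ.*-assoc k b b) (ℕ.*-monoˡ-≤ b kb≤0)
      finish p@(suc _) k@(suc _) _ 2p≤nb quad =
        ℕ.*-cancelˡ-≤ (p * n * n * k) {{ℕ.m*n≢0 (p * n * n) k {{ℕ.m*n≢0 (p * n) n {{ℕ.m*n≢0 p n}}}}}}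
          (ℕ.+-cancelˡ-≤ (8 * p * p * n * n * k * k + 3 * (p * n * n * k * k * b * b)) _ _ (begin
            8 * p * p * n * n * k * k + 3 * (p * n * n * k * k * b * b) + p * n * n * k * (k * (b * b))
              ≡⟨ step₁ p n k b ⟩
            8 * p * p * n * k * (k * n) + 4 * p * n * n * k * b * (k * b)
              ≤⟨ quad ⟩
            4 * p * p * n * n * (k * (k + w))
              + (4 * p * p * k * k * (n * n) + (4 * p * n * k * k * b + n * n * k * k * b * b) * p)
              ≡⟨ step₂ p n k b w ⟩
            8 * p * p * n * n * k * k + p * n * n * k * (4 * p * w) + p * n * n * k * k * b * b
              + 2 * p * n * k * k * b * (2 * p)
              -- Few points enter here: the cross term becomes two copies of pn²k²b². With the copy
              -- already present it uses up three of the four on the left, and the fourth gives the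
              -- conclusion.
              ≤⟨ ℕ.+-monoʳ-≤ _ (ℕ.*-monoʳ-≤ (2 * p * n * k * k * b) 2p≤nb) ⟩
            8 * p * p * n * n * k * k + p * n * n * k * (4 * p * w) + p * n * n * k * k * b * b
              + 2 * p * n * k * k * b * (n * b)
              ≡⟨ step₃ p n k b w ⟩
            8 * p * p * n * n * k * k + 3 * (p * n * n * k * k * b * b) + p * n * n * k * (4 * p * w) ∎))
        where
        open ℕ.≤-Reasoning
        step₁ : ∀ p n k b → 8 * p * p * n * n * k * k + 3 * (p * n * n * k * k * b * b) + p * n * n * k * (k * (b * b))
                ≡ 8 * p * p * n * k * (k * n) + 4 * p * n * n * k * b * (k * b)
        step₁ = solve-∀
        step₂ : ∀ p n k b w → 4 * p * p * n * n * (k * (k + w))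
                  + (4 * p * p * k * k * (n * n) + (4 * p * n * k * k * b + n * n * k * k * b * b) * p)
                ≡ 8 * p * p * n * n * k * k + p * n * n * k * (4 * p * w) + p * n * n * k * k * b * b
                  + 2 * p * n * k * k * b * (2 * p)
        step₂ = solve-∀
        step₃ : ∀ p n k b w → 8 * p * p * n * n * k * k + p * n * n * k * (4 * p * w) + p * n * n * k * k * b * b
                  + 2 * p * n * k * k * b * (n * b)
                ≡ 8 * p * p * n * n * k * k + 3 * (p * n * n * k * k * b * b) + p * n * n * k * (4 * p * w)
        step₃ = solve-∀

-- Listing the members of a subset

-- Each index is paired with its membership proof because functions on `El S` need one as input;
-- uniqueness and equality look at the index alone.
members : ∀ {n} (S : Subset n) → List (∃ (_∈ S))
members []            = []
members (outside ∷ S) = map (λ (i , i∈S) → suc i , Vec.there i∈S) (members S)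
members (inside ∷ S)  = (zero , Vec.here) ∷ map (λ (i , i∈S) → suc i , Vec.there i∈S) (members S)

length-members : ∀ {n} (S : Subset n) → length (members S) ≡ ∣ S ∣
length-members []            = ≡.refl
length-members (outside ∷ S) = ≡.trans (length-map _ (members S)) (length-members S)
length-members (inside ∷ S)  = ≡.cong suc (≡.trans (length-map _ (members S)) (length-members S))

∈-members : ∀ {n} {S : Subset n} {i} (i∈S : i ∈ S) → (i , i∈S) ∈ˡ members S
∈-members Vec.here                           = here ≡.refl
∈-members {S = inside  ∷ S} (Vec.there i∈S) = there (∈-map⁺ _ (∈-members i∈S))
∈-members {S = outside ∷ S} (Vec.there i∈S) = ∈-map⁺ _ (∈-members i∈S)

members-unique : ∀ {n} (S : Subset n) → Unique (On.setoid {B = ∃ (_∈ S)} (≡.setoid (Fin n)) proj₁) (members S)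
members-unique []            = []
members-unique (outside ∷ S) = Unique.map⁺ (On.setoid (≡.setoid _) proj₁) (On.setoid (≡.setoid _) proj₁)
  Fin.suc-injective (members-unique S)
members-unique (inside ∷ S)  = All.map⁺ (All.universal (λ _ ()) (members S))
  ∷ Unique.map⁺ (On.setoid (≡.setoid _) proj₁) (On.setoid (≡.setoid _) proj₁) Fin.suc-injective (members-unique S)

-- Lists of ring elements, inverses, and membership in products and images

module FiniteRingProperties {a ℓ} (R : FiniteCommutativeRing a ℓ) where
  open FiniteRing R hiding (zero)
  open GroupProperties +-group public using () renaming (∙-cancelˡ to +-cancelˡ; ∙-cancelʳ to +-cancelʳ)
  open NaturalCoefficients commutativeSemiring using (solve; _:=_; _:+_; _:*_)
  open import Relation.Binary.Reasoning.Setoid setoid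

  element-injective : ∀ {i j} → element i ≈ element j → i ≡ j
  element-injective {i} {j} eq = ≡.trans (≡.sym (index-element i)) (≡.trans (index-cong eq) (index-element j))

  ∈ᴿ-resp : ∀ (S : Subset size) {x y} → x ≈ y → x ∈ᴿ S → y ∈ᴿ S
  ∈ᴿ-resp S x≈y = ≡.subst (_∈ S) (index-cong x≈y)

  universe : List Carrier
  universe = map element (allFin size)

  length-universe : length universe ≡ size
  length-universe = ≡.trans (length-map element (allFin size)) (length-tabulate {n = size} (λ i → i))

  universe-unique : Unique setoid universe
  universe-unique = Unique.map⁺ (≡.setoid (Fin size)) setoid element-injective
    (Unique.tabulate⁺ (≡.setoid (Fin size)) (λ eq → eq))

  ∈-universe : ∀ x → element (index x) ∈ˡ universe
  ∈-universe x = ∈-map⁺ element (∈-allFin (index x))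

  module _ (S : Subset size) where

    private
      fromMember : ∃ (_∈ S) → El S
      fromMember (i , i∈S) = element i , ≡.subst (_∈ S) (≡.sym (index-element i)) i∈S

    elements : List (El S)
    elements = map fromMember (members S)

    length-elements : length elements ≡ ∣ S ∣
    length-elements = ≡.trans (length-map fromMember (members S)) (length-members S)

    elements-unique : Unique ⟪ S ⟫ elements
    elements-unique = Unique.map⁺ (On.setoid (≡.setoid _) proj₁) ⟪ S ⟫ element-injective (members-unique S)

    -- The list holds the representatives chosen by the enumeration, so `x` is found only up to
    -- `_≈_`.
    ∈-elements : ∀ {x} → x ∈ᴿ S → ∃ λ y → y ∈ˡ elements × proj₁ y ≈ x
    ∈-elements {x} x∈S = _ , ∈-map⁺ fromMember (∈-members x∈S) , element-index x

  unit-cancelˡ : ∀ {x x⁻¹ y y′} → x * x⁻¹ ≈ 1# → x * y ≈ x * y′ → y ≈ y′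
  unit-cancelˡ {x} {x⁻¹} {y} {y′} inv eq = begin
    y               ≈⟨ *-identityˡ y ⟨
    1# * y          ≈⟨ *-congʳ inv ⟨
    x * x⁻¹ * y     ≈⟨ solve 3 (λ x i y → x :* i :* y := i :* (x :* y)) refl x x⁻¹ y ⟩
    x⁻¹ * (x * y)   ≈⟨ *-congˡ eq ⟩
    x⁻¹ * (x * y′)  ≈⟨ solve 3 (λ x i y → i :* (x :* y) := x :* i :* y) refl x x⁻¹ y′ ⟩
    x * x⁻¹ * y′    ≈⟨ *-congʳ inv ⟩
    1# * y′         ≈⟨ *-identityˡ y′ ⟩
    y′              ∎

  abstract
    -- Opaque, since the equation `x * y ≈ 1#` is all that is used of the chosen inverse.
    ∈R*⇒inverse : ∀ {x} → x ∈ᴿ R* → ∃ λ y → x * y ≈ 1#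
    ∈R*⇒inverse x∈R* with ∈-⟦⟧⁻ isUnit?
      (λ x≈x′ (y , yx≈1 , xy≈1) → y , trans (*-congˡ (sym x≈x′)) yx≈1 , trans (*-congʳ (sym x≈x′)) xy≈1) x∈R*
    ... | y , _ , xy≈1 = y , xy≈1

  -- The decision procedures inside _·_ and image have no accessible name; the terms given here are
  -- convertible to them.
  ·-intro : ∀ {B C} (b : El B) (c : El C) → (proj₁ b * proj₁ c) ∈ᴿ (B · C)
  ·-intro {B} {C} b c = ∈-⟦⟧⁺
    (λ t → ∃? B (λ b≈b′ (c , eq) → c , trans (*-congʳ (sym b≈b′)) eq)
      (λ b → ∃? C (λ c≈c′ eq → trans (*-congˡ (sym c≈c′)) eq) (λ c → proj₁ b * proj₁ c ≈? t)))
    (λ { s≈t (b , c , eq) → b , c , trans eq s≈t }) (b , c , refl)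

  image-intro : ∀ {S T} (f : Func (⟪ S ⟫ ×ₛ ⟪ T ⟫) setoid) {A B} (x : El S) (y : El T) →
                proj₁ x ∈ᴿ A → proj₁ y ∈ᴿ B → Func.to f (x , y) ∈ᴿ image {S} {T} f A B
  image-intro {S} {T} f {A} {B} x y x∈A y∈B = ∈-⟦⟧⁺
    (λ t → ∃? S
      (λ x≈x′ (y , x∈A , y∈B , eq) →
         y , ≡.subst (_∈ A) (index-cong x≈x′) x∈A , y∈B , trans (Func.cong f (sym x≈x′ , refl)) eq)
      (λ x → ∃? T
        (λ y≈y′ (x∈A , y∈B , eq) →
           x∈A , ≡.subst (_∈ B) (index-cong y≈y′) y∈B , trans (Func.cong f (refl , sym y≈y′)) eq)
        (λ y → (index (proj₁ x) ∈? A) ×-dec (index (proj₁ y) ∈? B) ×-dec (Func.to f (x , y) ≈? t))))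
    (λ { s≈t (x , y , x∈A , y∈B , eq) → x , y , x∈A , y∈B , trans eq s≈t })
    (x , y , x∈A , y∈B , refl)

-- Units outside the maximal ideal

module ValuationRingProperties {a ℓ q r} (R : FiniteValuationRing a ℓ q r) where
  open FiniteValuationRing R hiding (zero)
  open FiniteRingProperties finiteCommutativeRing
  open RingProperties ring using (-‿distribʳ-*)
  open NaturalCoefficients commutativeSemiring using (solve; _:=_; _:+_; _:*_)
  open import Relation.Binary.Reasoning.Setoid setoid

  private
    M : Subset size
    M = maximalIdeal

    open IsMaximalIdeal (proj₁ (proj₂ isLocal)) using (isIdeal; maximal)
    open IsIdeal isIdeal

    z^r≈0 : z ^ r ≈ 0#
    z^r≈0 = proj₁ nilpotencyDegree

    cancel-neg : ∀ {x y c} → c ≈ x - y → x ≈ y + c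
    cancel-neg {x} {y} {c} eq = begin
      x              ≈⟨ +-identityʳ x ⟨
      x + 0#         ≈⟨ +-congˡ (-‿inverseˡ y) ⟨
      x + (- y + y)  ≈⟨ solve 3 (λ x y n → x :+ (n :+ y) := y :+ (x :+ n)) refl x y (- y) ⟩
      y + (x - y)    ≈⟨ +-congˡ eq ⟨
      y + c          ∎

    sub-of-sum : ∀ {x y c} → x ≈ y + c → x - y ≈ c
    sub-of-sum {x} {y} {c} eq = begin
      x - y        ≈⟨ +-congʳ eq ⟩
      y + c - y    ≈⟨ solve 3 (λ y c n → y :+ c :+ n := c :+ (y :+ n)) refl y c (- y) ⟩
      c + (y - y)  ≈⟨ +-congˡ (-‿inverseʳ y) ⟩
      c + 0#       ≈⟨ +-identityʳ c ⟩
      c            ∎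

  -- By maximality M + xR = R, so 1 ∈ zR + xR; raising this to the power r removes the z-part.
  ∉M⇒inverse : ∀ {x} → ¬ (x ∈ᴿ M) → ∃ λ y → x * y ≈ 1#
  ∉M⇒inverse {x} x∉M = proj₁ (proj₂ (bezout r)) , (begin
    x * _                           ≈⟨ +-identityˡ _ ⟨
    0# + x * _                      ≈⟨ +-congʳ (trans (*-congʳ z^r≈0) (zeroˡ _)) ⟨
    z ^ r * proj₁ (bezout r) + x * _  ≈⟨ proj₂ (proj₂ (bezout r)) ⟨
    1#                              ∎)
    where
    -- This encodes t ∈ M + xR. The multiplier ranges over indices, which makes the condition
    -- decidable, so that the ideal is a `Subset` to which `maximal` applies.
    InJ : Carrier → Set
    InJ t = ∃ λ i → (t + x * element i) ∈ᴿ M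

    InJ? : Decidable InJ
    InJ? t = Fin.any? (λ i → index (t + x * element i) ∈? M)

    intro : ∀ {t} y → (t + x * y) ∈ᴿ M → InJ t
    intro y ∈M = index y , ∈ᴿ-resp M (+-congˡ (*-congˡ (sym (element-index y)))) ∈M

    J : Subset size
    J = ⟦ InJ? ⟧

    into : ∀ {t} → InJ t → t ∈ᴿ J
    into = ∈-⟦⟧⁺ InJ? (λ t≈t′ (i , ∈M) → i , ∈ᴿ-resp M (+-congʳ t≈t′) ∈M)

    out : ∀ {t} → t ∈ᴿ J → InJ t
    out = ∈-⟦⟧⁻ InJ? (λ t≈t′ (i , ∈M) → i , ∈ᴿ-resp M (+-congʳ t≈t′) ∈M)

    M⊆J : ∀ {t} → t ∈ᴿ M → t ∈ᴿ J
    M⊆J {t} t∈M = into (intro 0# (∈ᴿ-resp M (sym (trans (+-congˡ (zeroʳ x)) (+-identityʳ t))) t∈M))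

    x∈J : x ∈ᴿ J
    x∈J = into (intro (- 1#) (∈ᴿ-resp M (sym (begin
      x + x * - 1#     ≈⟨ +-congˡ (-‿distribʳ-* x 1#) ⟨
      x + - (x * 1#)   ≈⟨ +-congˡ (-‿cong (*-identityʳ x)) ⟩
      x - x            ≈⟨ -‿inverseʳ x ⟩
      0#               ∎)) 0∈I))

    J-isIdeal : IsIdeal J
    J-isIdeal = record
      { 0∈I      = M⊆J 0∈I
      ; +-closed = λ {s} {t} s∈J t∈J → let (i , s∈) = out s∈J ; (j , t∈) = out t∈J in
          into (intro (element i + element j) (∈ᴿ-resp M
            (solve 5 (λ s t x i j → (s :+ x :* i) :+ (t :+ x :* j) := (s :+ t) :+ x :* (i :+ j))
              refl s t x (element i) (element j)) (+-closed s∈ t∈)))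
      ; *-absorb = λ s {t} t∈J → let (i , t∈) = out t∈J in
          into (intro (s * element i) (∈ᴿ-resp M
            (solve 4 (λ s t x i → s :* (t :+ x :* i) := s :* t :+ x :* (s :* i)) refl s t x (element i))
            (*-absorb s t∈)))
      }

    J≡⊤ : J ≡ ⊤
    J≡⊤ = maximal J J-isIdeal
      ( (λ {i} i∈M → ≡.subst (_∈ J) (index-element i) (M⊆J (≡.subst (_∈ M) (≡.sym (index-element i)) i∈M)))
      , index x , x∈J , x∉M )

    1∈zR+xR : ∃ λ k → ∃ λ y → 1# ≈ z * k + x * y
    1∈zR+xR with out {1#} (≡.subst (index 1# ∈_) (≡.sym J≡⊤) ∈⊤)
    ... | i , ∈M with Equivalence.to (z-generates _) ∈M
    ...   | k , zk≈ = k , - element i , (begin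
      1#                                         ≈⟨ +-identityʳ 1# ⟨
      1# + 0#                                    ≈⟨ +-congˡ (-‿inverseʳ (x * element i)) ⟨
      1# + (x * element i - x * element i)       ≈⟨ +-assoc _ _ _ ⟨
      1# + x * element i - x * element i         ≈⟨ +-cong (sym zk≈) (-‿distribʳ-* x (element i)) ⟩
      z * k + x * - element i                    ∎)

    bezout : ∀ j → ∃ λ k → ∃ λ y → 1# ≈ z ^ j * k + x * y
    bezout zero    = 1# , 0# , sym (trans (+-cong (*-identityʳ 1#) (zeroʳ x)) (+-identityʳ 1#))
    bezout (suc j) with 1∈zR+xR | bezout j
    ... | k , y , eq | kⱼ , yⱼ , eqⱼ = kⱼ * k , z ^ j * kⱼ * y + yⱼ , (begin
      1#                                               ≈⟨ eqⱼ ⟩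
      z ^ j * kⱼ + x * yⱼ                              ≈⟨ +-congʳ (*-identityʳ _) ⟨
      z ^ j * kⱼ * 1# + x * yⱼ                         ≈⟨ +-congʳ (*-congˡ eq) ⟩
      z ^ j * kⱼ * (z * k + x * y) + x * yⱼ            ≈⟨ solve 7 (λ z zʲ k y kⱼ yⱼ x →
          zʲ :* kⱼ :* (z :* k :+ x :* y) :+ x :* yⱼ := z :* zʲ :* (kⱼ :* k) :+ x :* (zʲ :* kⱼ :* y :+ yⱼ))
          refl z (z ^ j) k y kⱼ yⱼ x ⟩
      z * z ^ j * (kⱼ * k) + x * (z ^ j * kⱼ * y + yⱼ) ∎)

  -- Expansions in powers of z and the sizes of R and M

  private
    digit : Fin q → Carrier
    digit = Inverse.from residueCardinality

    class : Carrier → Fin q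
    class = Inverse.to residueCardinality

    class-cong : ∀ {x y} → z ∣ˡ (x - y) → class x ≡ class y
    class-cong = Inverse.to-cong residueCardinality

    -- The j base-q digits of the index, most significant first, become the coefficients of z⁰, ...,
    -- z^(j-1), each read as the chosen representative of a residue class.
    expand : ∀ j → Fin (q ℕ.^ j) → Carrier
    expand zero    _ = 0#
    expand (suc j) i = digit (proj₁ (remQuot {q} (q ℕ.^ j) i)) + z * expand j (proj₂ (remQuot {q} (q ℕ.^ j) i))

    -- x differs from the representative of its residue class by a multiple zk, and k is expanded in
    -- turn. The remainder `z ^ j * y` vanishes once j = r.
    expand-surjective : ∀ j x → ∃ λ i → ∃ λ y → x ≈ expand j i + z ^ j * y
    expand-surjective zero    x = zero , x , sym (trans (+-identityˡ _) (*-identityˡ x))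
    expand-surjective (suc j) x
      with Setoid.sym (residueRing z) {digit (class x)} {x} (Inverse.strictlyInverseʳ residueCardinality x)
    ... | k , zk≈ with expand-surjective j k
    ...   | i , y , k≈ = combine (class x) i , y , (begin
      x                                            ≈⟨ cancel-neg zk≈ ⟩
      digit (class x) + z * k                      ≈⟨ +-congˡ (*-congˡ k≈) ⟩
      digit (class x) + z * (expand j i + z ^ j * y)  ≈⟨ solve 5 (λ d z e zʲ y →
        d :+ z :* (e :+ zʲ :* y) := (d :+ z :* e) :+ z :* zʲ :* y) refl _ z (expand j i) (z ^ j) y ⟩
      digit (class x) + z * expand j i + z * z ^ j * y
        ≡⟨ ≡.cong (λ w → digit (proj₁ w) + z * expand j (proj₂ w) + z * z ^ j * y)
                  (Fin.remQuot-combine (class x) i) ⟨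
      expand (suc j) (combine (class x) i) + z * z ^ j * y ∎)

    -- Since z cannot be cancelled, the induction moves a factor z from the tail into the prefix
    -- `z ^ l`. If x - x′ were outside M it would be a unit, and z^l (x - x′) = 0 would give z^l =
    -- 0; but l < r as long as a digit remains. So z divides x - x′, the leading digits agree, and
    -- subtracting them leaves the tails with prefix z^(l+1).
    expand-injective : ∀ j l → l ℕ.+ j ≡ r → ∀ i i′ → z ^ l * expand j i ≈ z ^ l * expand j i′ → i ≡ i′
    expand-injective zero    l _     zero zero _  = ≡.refl
    expand-injective (suc j) l l+j≡r i    i′   eq =
      ≡.trans (≡.sym (Fin.combine-remQuot {q} (q ℕ.^ j) i)) (≡.trans
        (≡.cong₂ combine d≡d′ (expand-injective j (suc l) (≡.trans (≡.sym (ℕ.+-suc l j)) l+j≡r) _ _ tail-eq))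
        (Fin.combine-remQuot {q} (q ℕ.^ j) i′))
      where
      x  = expand (suc j) i
      x′ = expand (suc j) i′
      d  = proj₁ (remQuot {q} (q ℕ.^ j) i)
      d′ = proj₁ (remQuot {q} (q ℕ.^ j) i′)
      e  = expand j (proj₂ (remQuot {q} (q ℕ.^ j) i))
      e′ = expand j (proj₂ (remQuot {q} (q ℕ.^ j) i′))

      difference≈0 : z ^ l * (x - x′) ≈ 0#
      difference≈0 = begin
        z ^ l * (x - x′)              ≈⟨ distribˡ _ x (- x′) ⟩
        z ^ l * x + z ^ l * - x′      ≈⟨ +-cong eq (sym (-‿distribʳ-* _ x′)) ⟩
        z ^ l * x′ - z ^ l * x′       ≈⟨ -‿inverseʳ _ ⟩
        0#                            ∎

      x~x′ : z ∣ˡ (x - x′)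
      x~x′ with index (x - x′) ∈? M
      ... | yes ∈M = Equivalence.to (z-generates _) ∈M
      ... | no  ∉M with ∉M⇒inverse ∉M
      ...   | w , inv = contradiction
        (begin
          z ^ l                  ≈⟨ *-identityʳ _ ⟨
          z ^ l * 1#             ≈⟨ *-congˡ inv ⟨
          z ^ l * ((x - x′) * w) ≈⟨ *-assoc _ _ _ ⟨
          z ^ l * (x - x′) * w   ≈⟨ *-congʳ difference≈0 ⟩
          0# * w                 ≈⟨ zeroˡ w ⟩
          0#                     ∎)
        (proj₂ nilpotencyDegree l (≡.subst (l ℕ.<_) l+j≡r (ℕ.m<m+n l (s≤s z≤n))))

      leading : ∀ d e → class (digit d + z * e) ≡ d
      leading d e = ≡.trans (class-cong (e , sym (sub-of-sum refl))) (Inverse.strictlyInverseˡ residueCardinality d)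

      d≡d′ : d ≡ d′
      d≡d′ = ≡.trans (≡.sym (leading d e)) (≡.trans (class-cong x~x′) (leading d′ e′))

      tail-eq : z ^ suc l * e ≈ z ^ suc l * e′
      tail-eq = +-cancelˡ (z ^ l * digit d) _ _ (begin
        z ^ l * digit d + z * z ^ l * e     ≈⟨ regroup (digit d) e ⟩
        z ^ l * x                           ≈⟨ eq ⟩
        z ^ l * x′                          ≈⟨ regroup (digit d′) e′ ⟨
        z ^ l * digit d′ + z * z ^ l * e′   ≡⟨ ≡.cong (λ d → z ^ l * digit d + z * z ^ l * e′) d≡d′ ⟨
        z ^ l * digit d + z * z ^ l * e′    ∎)
        where
        regroup : ∀ d e → z ^ l * d + z * z ^ l * e ≈ z ^ l * (d + z * e)
        regroup d e = solve 4 (λ d e z zˡ → zˡ :* d :+ z :* zˡ :* e := zˡ :* (d :+ z :* e)) refl d e z (z ^ l)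

  -- Taking r digits is injective because the remainder is a multiple of z^r = 0; conversely
  -- `expand r` is injective by the case l = 0.
  size≡q^r : size ≡ q ℕ.^ r
  size≡q^r = ℕ.≤-antisym
    (Fin.injective⇒≤ {f = proj₁ ∘ expand-surjective r ∘ element} λ {i} {j} eq →
      element-injective (trans (expansion (element i)) (trans
        (reflexive (≡.cong (expand r) eq)) (sym (expansion (element j))))))
    (Fin.injective⇒≤ {f = index ∘ expand r} λ {i} {j} eq →
      expand-injective r 0 ≡.refl i j (*-congˡ (trans (sym (element-index _)) (trans
        (reflexive (≡.cong element eq)) (element-index _)))))
    where
    expansion : ∀ x → x ≈ expand r (proj₁ (expand-surjective r x))
    expansion x with expand-surjective r x
    ... | i , y , x≈ = trans x≈ (trans (+-congˡ (trans (*-congʳ z^r≈0) (zeroˡ y))) (+-identityʳ _))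

  -- M consists of the multiples zw, and zw depends only on the first r - 1 digits of w, since the
  -- remainder of w picks up the factor z · z^(r-1) = 0.
  ∣M∣≤q^r-1 : ∀ s → r ≡ suc s → ∣ M ∣ ℕ.≤ q ℕ.^ s
  ∣M∣≤q^r-1 s r≡1+s = ≡.subst₂ ℕ._≤_
    (≡.trans (∑-const (elements M) 1) (≡.trans (ℕ.*-identityʳ _) (length-elements M)))
    (≡.trans (ℕ.*-identityʳ _) (≡.trans (∑-const (allFin (q ℕ.^ s)) 1)
      (≡.trans (ℕ.*-identityʳ _) (length-tabulate {n = q ℕ.^ s} (λ i → i)))))
    (double-count (elements M) (allFin (q ℕ.^ s)) (λ x i → χ (proj₁ x ≈? z * expand s i)) covered few)
    where
    covered : ∀ x → x ∈ˡ elements M → 1 ℕ.≤ ∑ (allFin (q ℕ.^ s)) (λ i → 1 ℕ.* χ (proj₁ x ≈? z * expand s i))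
    covered (x , x∈M) _ with Equivalence.to (z-generates x) x∈M
    ... | w , zw≈x with expand-surjective s w
    ...   | i , y , w≈ = ℕ.≤-trans
      (ℕ.≤-reflexive (≡.sym (≡.trans (ℕ.*-identityˡ _) (χ-yes (x ≈? z * expand s i) (begin
        x                                   ≈⟨ zw≈x ⟨
        z * w                               ≈⟨ *-congˡ w≈ ⟩
        z * (expand s i + z ^ s * y)        ≈⟨ solve 4 (λ z e zˢ y → z :* (e :+ zˢ :* y) := z :* e :+ z :* zˢ :* y)
                                                 refl z (expand s i) (z ^ s) y ⟩
        z * expand s i + z ^ suc s * y      ≡⟨ ≡.cong (λ r → z * expand s i + z ^ r * y) r≡1+s ⟨
        z * expand s i + z ^ r * y          ≈⟨ +-congˡ (trans (*-congʳ z^r≈0) (zeroˡ y)) ⟩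
        z * expand s i + 0#                 ≈⟨ +-identityʳ _ ⟩
        z * expand s i                      ∎)))))
      (term≤∑ (λ i → 1 ℕ.* χ (x ≈? z * expand s i)) (∈-allFin i))
    few : ∀ i → i ∈ˡ allFin (q ℕ.^ s) → ∑ (elements M) (λ x → χ (proj₁ x ≈? z * expand s i)) ℕ.≤ 1
    few i _ = ∑-χ≤1 ⟪ M ⟫ (elements-unique M) (λ x → proj₁ x ≈? z * expand s i) (λ x≈ y≈ → trans x≈ (sym y≈))

  size*∣M∣≤q^[2r-1] : size ℕ.* ∣ M ∣ ℕ.≤ q ℕ.^ (2 ℕ.* r ℕ.∸ 1)
  size*∣M∣≤q^[2r-1] = go r ≡.refl
    where
    go : ∀ s → r ≡ s → size ℕ.* ∣ M ∣ ℕ.≤ q ℕ.^ (2 ℕ.* s ℕ.∸ 1)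
    -- For r = 0 truncated subtraction makes the exponent 0, so the bound to prove is 1.
    go zero    r≡0 = ℕ.*-mono-≤ size≤1 (ℕ.≤-trans (∣p∣≤n M) size≤1)
      where
      size≤1 : size ℕ.≤ 1
      size≤1 = ℕ.≤-reflexive (≡.trans size≡q^r (≡.cong (q ℕ.^_) r≡0))
    go (suc s) r≡1+s = ℕ.≤-trans
      (ℕ.*-mono-≤ (ℕ.≤-reflexive (≡.trans size≡q^r (≡.cong (q ℕ.^_) r≡1+s))) (∣M∣≤q^r-1 s r≡1+s))
      (ℕ.≤-reflexive (≡.trans (≡.sym (ℕ.^-distribˡ-+-* q (suc s) s)) (≡.cong (q ℕ.^_)
        (≡.trans (ℕ.+-comm (suc s) s) (≡.cong (λ t → s ℕ.+ suc t) (≡.sym (ℕ.+-identityʳ s)))))))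

-- The lines attached to A × C and the grid (B · C) × f(A , B)

module SumProduct {a ℓ q r} (R : FiniteValuationRing a ℓ q r) where

  open FiniteValuationRing R hiding (zero)

  open FiniteRingProperties finiteCommutativeRing
  open ValuationRingProperties R
  open NaturalCoefficients commutativeSemiring using (solve; _:=_; _:+_; _:*_)
  open import Relation.Binary.Reasoning.Setoid setoid

  module _ {G : Subset size} (isSubgroup : IsSubgroup G) (g h : Func ⟪ G ⟫ ⟪ R* ⟫)
           {A B C : Subset size} (A⊆G : A ⊆ G) (B⊆R* : B ⊆ R*) (C⊆R* : C ⊆ R*) where

    private
      T S M : Subset size
      T = B · C
      S = image (twistedSum g h) A B
      M = maximalIdeal

      m : ℕ
      m = μ (pointwiseProduct g h)

      inG : El A → El G
      inG (x , x∈A) = x , A⊆G x∈A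

      γ η : El A → Carrier
      γ x = proj₁ (Func.to g (inG x))
      η x = proj₁ (Func.to h (inG x))

      γ-inverse : ∀ x → ∃ λ y → γ x * y ≈ 1#
      γ-inverse x = ∈R*⇒inverse (proj₂ (Func.to g (inG x)))

      γ-cong : ∀ {x x′} → proj₁ x ≈ proj₁ x′ → γ x ≈ γ x′
      γ-cong = Func.cong g

      c-inverse : (c : El C) → ∃ λ y → proj₁ c * y ≈ 1#
      c-inverse (c , c∈C) = ∈R*⇒inverse (C⊆R* c∈C)

      inv : El C → Carrier
      inv c = proj₁ (c-inverse c)

      -- A line is kept as its parameters, so different pairs may describe the same point set and
      -- are counted with multiplicity. Coinciding lines have slope difference 0 ∈ M, so they fall
      -- under the degenerate count.
      Line : Set a
      Line = El A × El C

      slope offset : Line → Carrier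
      slope  (x , c) = γ x * inv c
      offset (x , c) = γ x * η x

      lineSetoid : Setoid _ _
      lineSetoid = ⟪ A ⟫ ×ₛ ⟪ C ⟫

      _on_ : Carrier × Carrier → Line → Set ℓ
      (t , s) on l = s ≈ slope l * t + offset l

      on? : ∀ y l → Dec (y on l)
      on? (t , s) l = s ≈? slope l * t + offset l

      incident : Line → Carrier × Carrier → ℕ
      incident l y = χ (on? y l)

      inTS? : (y : Carrier × Carrier) → Dec (proj₁ y ∈ᴿ T × proj₂ y ∈ᴿ S)
      inTS? (t , s) = (index t ∈? T) ×-dec (index s ∈? S)

      weight : Carrier × Carrier → ℕ
      weight y = χ (inTS? y)

      lines : List Line
      lines = cartesianProduct (elements A) (elements C)

      points : List (Carrier × Carrier)
      points = cartesianProduct universe universe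

      lines-unique : Unique lineSetoid lines
      lines-unique = Unique.cartesianProduct⁺ ⟪ A ⟫ ⟪ C ⟫ (elements-unique A) (elements-unique C)

      points-unique : Unique (setoid ×ₛ setoid) points
      points-unique = Unique.cartesianProduct⁺ setoid setoid universe-unique universe-unique

      ∑1 : ∀ {x} {X : Set x} (xs : List X) → ∑ xs (λ _ → 1) ≡ length xs
      ∑1 xs = ≡.trans (∑-const xs 1) (ℕ.*-identityʳ _)

      length-lines : length lines ≡ ∣ A ∣ ℕ.* ∣ C ∣
      length-lines = ≡.trans (length-× (elements A) (elements C)) (≡.cong₂ ℕ._*_ (length-elements A) (length-elements C))

      length-points : length points ≡ size ℕ.* size
      length-points = ≡.trans (length-× universe universe) (≡.cong₂ ℕ._*_ length-universe length-universe)

      line-size : ∀ l → l ∈ˡ lines → ∑ points (incident l) ≡ size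
      line-size l _ = ≡.trans (∑-× universe universe (incident l))
        (≡.trans (∑-cong universe (λ t → one (slope l * t + offset l))) (≡.trans (∑1 universe) length-universe))
        where
        one : ∀ x → ∑ universe (λ s → χ (s ≈? x)) ≡ 1
        one x = ℕ.≤-antisym
          (∑-χ≤1 setoid universe-unique (λ s → s ≈? x) (λ s≈x t≈x → trans s≈x (sym t≈x)))
          (ℕ.≤-trans (ℕ.≤-reflexive (≡.sym (χ-yes (element (index x) ≈? x) (element-index x))))
                     (term≤∑ (λ s → χ (s ≈? x)) (∈-universe x)))

      weight-total : ∑ points weight ℕ.≤ ∣ S ∣ ℕ.* ∣ T ∣
      weight-total = ≡.subst (∑ points weight ℕ.≤_)
        (≡.trans (ℕ.*-identityʳ _) (≡.trans (∑1 TS) (≡.trans (length-× (elements T) (elements S))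
          (≡.trans (≡.cong₂ ℕ._*_ (length-elements T) (length-elements S)) (ℕ.*-comm ∣ T ∣ ∣ S ∣)))))
        (double-count points TS (λ y e → χ (same? y e)) covered few)
        where
        TS : List (El T × El S)
        TS = cartesianProduct (elements T) (elements S)
        same? : ∀ y (e : El T × El S) → Dec (proj₁ (proj₁ e) ≈ proj₁ y × proj₁ (proj₂ e) ≈ proj₂ y)
        same? (t , s) ((t′ , _) , (s′ , _)) = (t′ ≈? t) ×-dec (s′ ≈? s)
        covered : ∀ y → y ∈ˡ points → weight y ℕ.≤ ∑ TS (λ e → 1 ℕ.* χ (same? y e))
        covered y _ = χ≤ (inTS? y) λ (t∈T , s∈S) →
          let (t′ , t′∈ , t′≈t) = ∈-elements T t∈T
              (s′ , s′∈ , s′≈s) = ∈-elements S s∈S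
          in ℕ.≤-trans
            (ℕ.≤-reflexive (≡.sym (≡.trans (ℕ.*-identityˡ _) (χ-yes (same? y (t′ , s′)) (t′≈t , s′≈s)))))
            (term≤∑ (λ e → 1 ℕ.* χ (same? y e)) (∈-cartesianProduct⁺ t′∈ s′∈))
        few : ∀ e → e ∈ˡ TS → ∑ points (λ y → χ (same? y e)) ℕ.≤ 1
        few e _ = ∑-χ≤1 (setoid ×ₛ setoid) points-unique (λ y → same? y e)
          (λ (t≈ , s≈) (t′≈ , s′≈) → trans (sym t≈) t′≈ , trans (sym s≈) s′≈)

      -- Each b ∈ B contributes the grid point (bc , f(x , b)). Different b have different abscissae
      -- because c is invertible, so comparing abscissae in `above?` is enough to separate these
      -- points.
      rich : ∀ l → l ∈ˡ lines → ∣ B ∣ ℕ.≤ ∑ points (λ y → weight y ℕ.* incident l y)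
      rich l@(x , c) _ = ≡.subst₂ ℕ._≤_ (≡.trans (∑1 (elements B)) (length-elements B)) (ℕ.*-identityʳ _)
        (double-count (elements B) points (λ b y → χ (above? b y)) covered few)
        where
        above? : ∀ (b : El B) (y : Carrier × Carrier) → Dec (proj₁ b * proj₁ c ≈ proj₁ y)
        above? b y = proj₁ b * proj₁ c ≈? proj₁ y
        few : ∀ y → y ∈ˡ points → ∑ (elements B) (λ b → χ (above? b y)) ℕ.≤ 1
        few y _ = ∑-χ≤1 ⟪ B ⟫ (elements-unique B) (λ b → above? b y)
          (λ bc≈t b′c≈t → unit-cancelˡ (proj₂ (c-inverse c))
            (trans (*-comm _ _) (trans bc≈t (trans (sym b′c≈t) (*-comm _ _)))))
        covered : ∀ b → b ∈ˡ elements B → 1 ℕ.≤ ∑ points (λ y → weight y ℕ.* incident l y ℕ.* χ (above? b y))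
        covered b@(b₀ , b∈B) _ = ℕ.≤-trans
          (ℕ.≤-reflexive (≡.sym (≡.cong₂ ℕ._*_ (≡.cong₂ ℕ._*_
            (χ-yes (inTS? y) (∈ᴿ-resp T (sym t≈) (·-intro b c) , ∈ᴿ-resp S (sym s≈) s₀∈S))
            (χ-yes (on? y l) on)) (χ-yes (above? b y) (sym t≈)))))
          (term≤∑ (λ y → weight y ℕ.* incident l y ℕ.* χ (above? b y))
            (∈-cartesianProduct⁺ (∈-universe t₀) (∈-universe s₀)))
          where
          t₀ = b₀ * proj₁ c
          s₀ = γ x * (η x + b₀)
          y = element (index t₀) , element (index s₀)
          t≈ : proj₁ y ≈ t₀
          t≈ = element-index t₀
          s≈ : proj₂ y ≈ s₀
          s≈ = element-index s₀
          s₀∈S : s₀ ∈ᴿ S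
          s₀∈S = image-intro (twistedSum g h) (inG x) (b₀ , B⊆R* b∈B) (proj₂ x) b∈B
          on : y on l
          on = begin
            proj₂ y                                ≈⟨ s≈ ⟩
            γ x * (η x + b₀)                       ≈⟨ distribˡ _ _ _ ⟩
            γ x * η x + γ x * b₀                   ≈⟨ +-comm _ _ ⟩
            γ x * b₀ + γ x * η x                   ≈⟨ +-congʳ (*-identityʳ _) ⟨
            γ x * b₀ * 1# + γ x * η x              ≈⟨ +-congʳ (*-congˡ (proj₂ (c-inverse c))) ⟨
            γ x * b₀ * (proj₁ c * inv c) + γ x * η x
              ≈⟨ +-congʳ (solve 4 (λ γ b c i → γ :* b :* (c :* i) := γ :* i :* (b :* c)) refl (γ x) b₀ (proj₁ c) (inv c)) ⟩
            slope l * t₀ + offset l                ≈⟨ +-congʳ (*-congˡ t≈) ⟨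
            slope l * proj₁ y + offset l           ∎

      -- Common points of a fixed line with all the others

      module _ (l : Line) where

        Meet : Line → Carrier → Set ℓ
        Meet l′ t = slope l * t + offset l ≈ slope l′ * t + offset l′

        meet? : ∀ l′ t → Dec (Meet l′ t)
        meet? l′ t = slope l * t + offset l ≈? slope l′ * t + offset l′

        gap : Line → Carrier
        gap l′ = slope l′ - slope l

        slope≈ : ∀ l′ → slope l′ ≈ slope l + gap l′
        slope≈ l′ = begin
          slope l′                            ≈⟨ +-identityʳ _ ⟨
          slope l′ + 0#                       ≈⟨ +-congˡ (-‿inverseʳ _) ⟨
          slope l′ + (slope l - slope l)      ≈⟨ solve 3 (λ x y n → x :+ (y :+ n) := y :+ (x :+ n)) refl _ _ _ ⟩
          slope l + gap l′                    ∎

        -- This form serves twice: a unit gap and the two offsets determine t, while t, the gap and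
        -- the offset of `l` determine the offset of `l′`.
        Meet⇒ : ∀ {l′ t} → Meet l′ t → gap l′ * t + offset l′ ≈ offset l
        Meet⇒ {l′} {t} eq = +-cancelˡ (slope l * t) _ _ (begin
          slope l * t + (gap l′ * t + offset l′)
            ≈⟨ solve 4 (λ u d t v → u :* t :+ (d :* t :+ v) := (u :+ d) :* t :+ v) refl _ _ _ _ ⟩
          (slope l + gap l′) * t + offset l′       ≈⟨ +-congʳ (*-congʳ (slope≈ l′)) ⟨
          slope l′ * t + offset l′                 ≈⟨ eq ⟨
          slope l * t + offset l                   ∎)

        degenerate? : ((l′ , t) : Line × Carrier) → Dec (gap l′ ∈ᴿ M × Meet l′ t)
        degenerate? (l′ , t) = (index (gap l′) ∈? M) ×-dec meet? l′ t

        -- A common point is determined by its abscissa. If the gap lies outside M it is a unit and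
        -- `Meet⇒` has at most one solution t, which the summand 1 accounts for; if it lies in M,
        -- every common abscissa is degenerate.
        common-points : ∀ l′ → ∑ points (λ y → incident l y ℕ.* incident l′ y)
                               ℕ.≤ 1 ℕ.+ ∑ universe (λ t → χ (degenerate? (l′ , t)))
        common-points l′ = ℕ.≤-trans byAbscissa bound
          where
          both? : ∀ y → Dec (y on l × y on l′)
          both? y = on? y l ×-dec on? y l′

          byAbscissa : ∑ points (λ y → incident l y ℕ.* incident l′ y) ℕ.≤ ∑ universe (λ t → χ (meet? l′ t))
          byAbscissa = ℕ.≤-trans
            (ℕ.≤-reflexive (≡.trans (∑-cong points (λ y → χ-* (on? y l) (on? y l′)))
                                    (∑-× universe universe (λ y → χ (both? y)))))
            (∑-mono universe λ t _ → column t)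
            where
            column : ∀ t → ∑ universe (λ s → χ (both? (t , s))) ℕ.≤ χ (meet? l′ t)
            column t = byMeet (meet? l′ t)
              where
              byMeet : (d : Dec (Meet l′ t)) → ∑ universe (λ s → χ (both? (t , s))) ℕ.≤ χ d
              byMeet (yes _)    = ∑-χ≤1 setoid universe-unique (λ s → both? (t , s))
                (λ (s≈ , _) (s′≈ , _) → trans s≈ (sym s′≈))
              byMeet (no ¬meet) = ≡.subst (∑ universe (λ s → χ (both? (t , s))) ℕ.≤_)
                (≡.trans (∑-const universe 0) (ℕ.*-zeroʳ (length universe)))
                (∑-mono universe λ s _ → χ≤ (both? (t , s)) λ (s≈ , s≈′) → contradiction (trans (sym s≈) s≈′) ¬meet)

          bound : ∑ universe (λ t → χ (meet? l′ t)) ℕ.≤ 1 ℕ.+ ∑ universe (λ t → χ (degenerate? (l′ , t)))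
          bound = byGap (index (gap l′) ∈? M)
            where
            byGap : Dec (gap l′ ∈ᴿ M) →
                    ∑ universe (λ t → χ (meet? l′ t)) ℕ.≤ 1 ℕ.+ ∑ universe (λ t → χ (degenerate? (l′ , t)))
            byGap (yes ∈M) = ℕ.≤-trans
              (∑-mono universe λ t _ → χ-mono (meet? l′ t) (degenerate? (l′ , t)) (∈M ,_)) (ℕ.n≤1+n _)
            byGap (no ∉M) = ℕ.≤-trans
              (∑-χ≤1 setoid universe-unique (meet? l′) λ meet meet′ →
                unit-cancelˡ (proj₂ (∉M⇒inverse ∉M))
                  (+-cancelʳ (offset l′) _ _ (trans (Meet⇒ meet) (sym (Meet⇒ meet′)))))
              (ℕ.m≤m+n 1 _)

        -- A degenerate pair (l′ , t) is determined by t, the gap d ∈ M and the first coordinate x of l′,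
        -- and x lies in the fibre of g h over offset l − d t.
        few-degenerate : ∑ (cartesianProduct lines universe) (λ p → χ (degenerate? p)) ℕ.≤ size ℕ.* ∣ M ∣ ℕ.* m
        few-degenerate = ≡.subst (λ k → ∑ pairs (λ p → χ (degenerate? p)) ℕ.≤ k ℕ.* m)
          (≡.trans (∑1 params) (≡.trans (length-× universe (elements M)) (≡.cong₂ ℕ._*_ length-universe (length-elements M))))
          (double-count pairs params (λ p e → χ (has? p e)) covered few)
          where
          pairs : List (Line × Carrier)
          pairs = cartesianProduct lines universe
          pairs-unique : Unique (lineSetoid ×ₛ setoid) pairs
          pairs-unique = Unique.cartesianProduct⁺ lineSetoid setoid lines-unique universe-unique
          params : List (Carrier × El M)
          params = cartesianProduct universe (elements M)
          Has : Line × Carrier → Carrier × El M → Set ℓ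
          Has (l′ , t) (t₀ , d , _) = t ≈ t₀ × slope l′ ≈ slope l + d × d * t₀ + offset l′ ≈ offset l
          has? : ∀ p e → Dec (Has p e)
          has? (l′ , t) (t₀ , d , _) = (t ≈? t₀) ×-dec (slope l′ ≈? slope l + d) ×-dec (d * t₀ + offset l′ ≈? offset l)
          covered : ∀ p → p ∈ˡ pairs → χ (degenerate? p) ℕ.≤ ∑ params (λ e → 1 ℕ.* χ (has? p e))
          covered p@(l′ , t) _ = χ≤ (degenerate? p) λ (gap∈M , meet) →
            let (d , d∈ , d≈gap) = ∈-elements M gap∈M
                t₀ = element (index t)
            in ℕ.≤-trans
              (ℕ.≤-reflexive (≡.sym (≡.trans (ℕ.*-identityˡ _) (χ-yes (has? p (t₀ , d))
                ( sym (element-index t)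
                , trans (slope≈ l′) (+-congˡ (sym d≈gap))
                , trans (+-congʳ (*-cong d≈gap (element-index t))) (Meet⇒ meet))))))
              (term≤∑ (λ e → 1 ℕ.* χ (has? p e)) (∈-cartesianProduct⁺ (∈-universe t) d∈))
          few : ∀ e → e ∈ˡ params → ∑ pairs (λ p → χ (has? p e)) ℕ.≤ m
          few e@(t₀ , d , _) _ = ℕ.≤-trans
            (double-count pairs (elements F) (λ p y → χ (over? p y)) covered′ few′)
            (ℕ.≤-trans (ℕ.≤-reflexive (≡.trans (ℕ.*-identityʳ _) (≡.trans (∑1 (elements F)) (length-elements F))))
                       ∣F∣≤m)
            where
            v : Carrier
            v = offset l - d * t₀
            φ = pointwiseProduct g h
            -- `μ` is a maximum over chosen representatives, so the fibre is taken over `element i`,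
            -- which equals v up to `_≈_`.
            i = index v
            F : Subset size
            F = ⟦ fibre? φ (element i) ⟧
            ∣F∣≤m : ∣ F ∣ ℕ.≤ m
            ∣F∣≤m = All.lookup (xs≤max 0 _) (∈-map⁺ (λ i → ∣ ⟦ fibre? φ (element i) ⟧ ∣) (∈-allFin i))
            Over : Line × Carrier → El F → Set ℓ
            Over p@((x , _) , _) (y , _) = Has p e × proj₁ x ≈ y
            over? : ∀ p y → Dec (Over p y)
            over? p@((x , _) , _) (y , _) = has? p e ×-dec (proj₁ x ≈? y)
            covered′ : ∀ p → p ∈ˡ pairs → χ (has? p e) ℕ.≤ ∑ (elements F) (λ y → 1 ℕ.* χ (over? p y))
            covered′ p@(l′@(x , c) , t) _ = χ≤ (has? p e) λ has@(_ , _ , eq) →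
              let offset≈v : offset l′ ≈ v
                  offset≈v = begin
                    offset l′                            ≈⟨ +-identityʳ _ ⟨
                    offset l′ + 0#                       ≈⟨ +-congˡ (-‿inverseʳ (d * t₀)) ⟨
                    offset l′ + (d * t₀ - d * t₀)        ≈⟨ solve 3 (λ v w n → v :+ (w :+ n) := w :+ v :+ n) refl _ _ _ ⟩
                    d * t₀ + offset l′ - d * t₀          ≈⟨ +-congʳ eq ⟩
                    v                                    ∎
                  (y , y∈ , y≈x) = ∈-elements F (∈-⟦⟧⁺ (fibre? φ (element i)) (Fibre-resp φ _)
                    (proj₂ (inG x) , trans offset≈v (sym (element-index v))))
              in ℕ.≤-trans
                (ℕ.≤-reflexive (≡.sym (≡.trans (ℕ.*-identityˡ _) (χ-yes (over? p y) (has , sym y≈x)))))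
                (term≤∑ (λ y → 1 ℕ.* χ (over? p y)) y∈)
            few′ : ∀ y → y ∈ˡ elements F → ∑ pairs (λ p → χ (over? p y)) ℕ.≤ 1
            few′ y _ = ∑-χ≤1 (lineSetoid ×ₛ setoid) pairs-unique (λ p → over? p y) same
              where
              same : ∀ {p p′} → Over p y → Over p′ y → Setoid._≈_ (lineSetoid ×ₛ setoid) p p′
              same {((x , c) , t)} {((x′ , c′) , t′)} ((t≈ , u≈ , _) , x≈y) ((t′≈ , u′≈ , _) , x′≈y) =
                (x≈x′ , c≈c′) , trans t≈ (sym t′≈)
                where
                x≈x′ : proj₁ x ≈ proj₁ x′
                x≈x′ = trans x≈y (sym x′≈y)
                -- The second coordinate is recovered from the slope: g(x) and g(x′) agree and are
                -- units, so they cancel and leave equal inverses, which in turn determine c.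
                inv≈ : inv c ≈ inv c′
                inv≈ = unit-cancelˡ (proj₂ (γ-inverse x))
                  (trans u≈ (trans (sym u′≈) (*-congʳ (γ-cong {x′} {x} (sym x≈x′)))))
                c≈c′ : proj₁ c ≈ proj₁ c′
                c≈c′ = unit-cancelˡ (trans (*-comm _ _) (proj₂ (c-inverse c))) (begin
                  inv c * proj₁ c      ≈⟨ trans (*-comm _ _) (proj₂ (c-inverse c)) ⟩
                  1#                   ≈⟨ trans (*-comm _ _) (proj₂ (c-inverse c′)) ⟨
                  inv c′ * proj₁ c′    ≈⟨ *-congʳ inv≈ ⟨
                  inv c * proj₁ c′     ∎)

        meets : ∑ lines (λ l′ → ∑ points (λ y → incident l y ℕ.* incident l′ y))
                ℕ.≤ length lines ℕ.+ size ℕ.* ∣ M ∣ ℕ.* m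
        meets = ℕ.≤-trans (∑-mono lines λ l′ _ → common-points l′) (ℕ.≤-trans
          (ℕ.≤-reflexive (≡.trans (∑-+ lines (λ _ → 1) _) (≡.cong₂ ℕ._+_ (∑1 lines)
            (≡.sym (∑-× lines universe (λ p → χ (degenerate? p)))))))
          (ℕ.+-monoʳ-≤ (length lines) few-degenerate))

      size-nonZero : NonZero size
      size-nonZero = Fin.nonZeroIndex (index 0#)

      module I = Incidence lines points incident weight
        (λ y → ≡.trans (χ-* (inTS? y) (inTS? y)) (ℕ.≤-antisym
          (χ-mono (inTS? y ×-dec inTS? y) (inTS? y) proj₁) (χ-mono (inTS? y) (inTS? y ×-dec inTS? y) (λ w → w , w))))
        size ∣ B ∣ (size ℕ.* ∣ M ∣ ℕ.* m) length-points line-size rich (λ l _ → meets l)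

    -- The case split is whether the grid has at least |R||B|/2 points. If so, |R||B| ≤ 2|S||T|
    -- follows at once and is relaxed by 2 ≤ 4 and 1 ≤ m. If not, `few-points⇒` applies with w =
    -- |R||M|m.
    dichotomy : q ℕ.^ r ℕ.* ∣ B ∣ ℕ.≤ 4 ℕ.* (∣ S ∣ ℕ.* ∣ T ∣) ℕ.* m
              ⊎ ∣ A ∣ ℕ.* ∣ B ∣ ℕ.^ 2 ℕ.* ∣ C ∣ ℕ.≤ 4 ℕ.* (∣ S ∣ ℕ.* ∣ T ∣) ℕ.* (m ℕ.^ 2 ℕ.* q ℕ.^ (2 ℕ.* r ℕ.∸ 1))
    dichotomy with ℕ.≤-total (2 ℕ.* ∑ points weight) (size ℕ.* ∣ B ∣)
    ... | inj₁ few = inj₂ (ℕ.≤-trans (ℕ.≤-reflexive lhs) (ℕ.≤-trans (I.few-points⇒ {{size-nonZero}} few)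
        (ℕ.*-mono-≤ (ℕ.*-monoʳ-≤ 4 weight-total) (ℕ.≤-trans
          -- The excess |R||M|m is at most q^(2r-1) m², using m ≤ m² for nonzero m.
          (ℕ.*-mono-≤ size*∣M∣≤q^[2r-1] (ℕ.m≤m*n m (m ℕ.^ 1) {{ℕ.m^n≢0 m 1 {{m≢0}}}}))
          (ℕ.≤-reflexive (ℕ.*-comm _ (m ℕ.^ 2)))))))
      where
      m≢0 : NonZero m
      m≢0 = μ-nonZero isSubgroup (pointwiseProduct g h)
      rearrange : ∀ a b c → a ℕ.* (b ℕ.* (b ℕ.* 1)) ℕ.* c ≡ a ℕ.* c ℕ.* (b ℕ.* b)
      rearrange = solve-∀
      lhs : ∣ A ∣ ℕ.* ∣ B ∣ ℕ.^ 2 ℕ.* ∣ C ∣ ≡ length lines ℕ.* (∣ B ∣ ℕ.* ∣ B ∣)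
      lhs = ≡.trans (rearrange (∣ A ∣) (∣ B ∣) (∣ C ∣)) (≡.cong (ℕ._* (∣ B ∣ ℕ.* ∣ B ∣)) (≡.sym length-lines))
    ... | inj₂ many = inj₁ (ℕ.≤-trans (ℕ.≤-reflexive (≡.cong (ℕ._* ∣ B ∣) (≡.sym size≡q^r))) (ℕ.≤-trans many
        (ℕ.≤-trans (ℕ.*-mono-≤ {2} {4} (s≤s (s≤s z≤n)) weight-total) (ℕ.m≤m*n _ m {{m≢0}}))))
      where
      m≢0 : NonZero m
      m≢0 = μ-nonZero isSubgroup (pointwiseProduct g h)

-- From natural number inequalities to the rational statement

open import Data.Integer.Base using (+_)

-- `_/_` reduces to lowest terms, which hides numerator and denominator. In unnormalised rationals
-- the order is cross-multiplication, and the claim becomes the hypothesis.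
quarter-≤ : ∀ N D P .{{_ : NonZero D}} → N ℕ.≤ 4 ℕ.* P ℕ.* D →
            (+ 1 / 4) ℚ.* (+ N / D) ℚ.≤ + P / 1
quarter-≤ N D@(suc d) P N≤4PD = ℚ.toℚᵘ-cancel-≤ (begin
  ℚ.toℚᵘ ((+ 1 / 4) ℚ.* (+ N / D))             ≃⟨ ℚ.toℚᵘ-homo-* (+ 1 / 4) (+ N / D) ⟩
  ℚ.toℚᵘ (+ 1 / 4) ℚᵘ.* ℚ.toℚᵘ (+ N / D)       ≃⟨ ℚᵘ.*-congˡ {ℚ.toℚᵘ (+ 1 / 4)} (ℚ.toℚᵘ-fromℚᵘ (ℚᵘ.mkℚᵘ (+ N) d)) ⟩
  (+ 1 ℚᵘ./ 4) ℚᵘ.* (+ N ℚᵘ./ D)               ≤⟨ ℚᵘ.*≤* ineq ⟩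
  + P ℚᵘ./ 1                                   ≃⟨ ℚ.toℚᵘ-fromℚᵘ (ℚᵘ.mkℚᵘ (+ P) 0) ⟨
  ℚ.toℚᵘ (+ P / 1)                             ∎)
  where
  open ℚᵘ.≤-Reasoning
  rearrange : ∀ P D → 4 ℕ.* P ℕ.* D ≡ P ℕ.* (4 ℕ.* D)
  rearrange = solve-∀
  ineq : + 1 ℤ.* + N ℤ.* + 1 ℤ.≤ + P ℤ.* + (4 ℕ.* D)
  ineq = ≡.subst₂ ℤ._≤_ (≡.sym (≡.trans (ℤ.*-identityʳ _) (ℤ.*-identityˡ (+ N)))) (ℤ.pos-* P (4 ℕ.* D))
    (ℤ.+≤+ (ℕ.≤-trans N≤4PD (ℕ.≤-reflexive (rearrange P D))))

quarter-⊓-≤ : ∀ N D N′ D′ P .{{_ : NonZero D}} .{{_ : NonZero D′}} →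
              N ℕ.≤ 4 ℕ.* P ℕ.* D ⊎ N′ ℕ.≤ 4 ℕ.* P ℕ.* D′ →
              + P / 1 ≥ (+ 1 / 4) ℚ.* ((+ N / D) ⊓ (+ N′ / D′))
quarter-⊓-≤ N D N′ D′ P (inj₁ le) =
  ℚ.≤-trans (ℚ.*-monoˡ-≤-nonNeg (+ 1 / 4) (ℚ.p⊓q≤p (+ N / D) (+ N′ / D′))) (quarter-≤ N D P le)
quarter-⊓-≤ N D N′ D′ P (inj₂ le) =
  ℚ.≤-trans (ℚ.*-monoˡ-≤-nonNeg (+ 1 / 4) (ℚ.p⊓q≤q (+ N / D) (+ N′ / D′))) (quarter-≤ N′ D′ P le)

theorem1p10 : ∀ {a ℓ} (r : ℕ) →
  ∃[ c ] (0ℚ < c) ×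
    (∀ {q} (R : FiniteValuationRing a ℓ q r) →
     let open FiniteValuationRing R in
     (G : Subset size) (isSubgroup : IsSubgroup G) (g h : Func ⟪ G ⟫ ⟪ R* ⟫) →
     let f = twistedSum g h
         m = μ (pointwiseProduct g h)
         e = 2 ℕ.* r ℕ.∸ 1
         instance
           m≢0 : NonZero m
           m≢0 = μ-nonZero isSubgroup (pointwiseProduct g h)
           d≢0 : NonZero (m ℕ.^ 2 ℕ.* q ℕ.^ e)
           d≢0 = m*n≢0 (m ℕ.^ 2) (q ℕ.^ e) {{m^n≢0 m 2}} {{m^n≢0 q e {{q-nonZero}}}}
     in
     (A B C : Subset size) → A ⊆ G → B ⊆ R* → C ⊆ R* →
     + (∣ image f A B ∣ ℕ.* ∣ B · C ∣) / 1
       ≥ c ℚ.* ((+ (q ℕ.^ r ℕ.* ∣ B ∣) / m)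
                ⊓ (+ (∣ A ∣ ℕ.* ∣ B ∣ ℕ.^ 2 ℕ.* ∣ C ∣) / (m ℕ.^ 2 ℕ.* q ℕ.^ e))))
-- The constant 1/4 inverts the factor 4 in `dichotomy`, which comes from squaring kb/2 in
-- Chebyshev's inequality.
theorem1p10 r = + 1 / 4 , ℚ.*<* (ℤ.+<+ (s≤s z≤n)) , λ {q} R G isSubgroup g h A B C A⊆G B⊆R* C⊆R* →
  let open FiniteValuationRing R
      m = μ (pointwiseProduct g h)
      e = 2 ℕ.* r ℕ.∸ 1
  in quarter-⊓-≤ (q ℕ.^ r ℕ.* ∣ B ∣) m (∣ A ∣ ℕ.* ∣ B ∣ ℕ.^ 2 ℕ.* ∣ C ∣) (m ℕ.^ 2 ℕ.* q ℕ.^ e)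
       (∣ image (twistedSum g h) A B ∣ ℕ.* ∣ B · C ∣)
       {{μ-nonZero isSubgroup (pointwiseProduct g h)}}
       {{m*n≢0 (m ℕ.^ 2) (q ℕ.^ e)
           {{m^n≢0 m 2 {{μ-nonZero isSubgroup (pointwiseProduct g h)}}}} {{m^n≢0 q e {{q-nonZero}}}}}}
       (SumProduct.dichotomy R isSubgroup g h A⊆G B⊆R* C⊆R*)
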